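{- Let $k\ge 1$ be a fixed integer. On input a hypergraph $H$, the algorithm det-$k$-decomp runs in time $$\mathcal{O}\bigl(n^{k+1}\,\min(n,ck)^k\,m^2\bigr),$$ where $n$ is the number of hyperedges of $H$, $m$ is the number of vertices of $H$, and $c$ is the maximum number of incident hyperedges over all hyperedges of $H$.
   Context: **Cost conventions.** It is assumed that standard set operations can be performed in constant time, and the cost of the auxiliary post-processing procedure $expand$ is ignored (it is not needed for the decision problem). $k$ is fixed, so constants in $\mathcal{O}$ may depend on $k$. A hyperedge $f$ is incident to a hyperedge $e$ if $e\cap f\ne\emptyset$ (so $e$ is counted as incident to itself), and $c=\max_{e\in edges(H)}|\{f\in edges(H): e\cap f\neq\emptyset\}|$. **Hypergraphs.** A hypergraph $H$ is a pair $(V,E)$ with $V$ a finite set of vertices and $E\subseteq 2^V\setminus\{\emptyset\}$ a set of hyperedges, where it is assumed that $V=\bigcup E$. Write $vertices(H)=V$, $edges(H)=E$. For a set $S$ of hyperedges, $\bigcup S$ is the set of vertices contained in some member of $S$. **Components.** For $W\subseteq V$, a set $V'\subseteq V$ is $[W]$-connected if any two of its vertices are joined by a path (a sequence of vertices in which consecutive vertices lie in a common hyperedge) not going through vertices in $W$. A $[W]$-component is a maximal $[W]$-connected non-empty set $V'\subseteq V\setminus W$. Components are represented by the set of hyperedges containing at least one vertex of the component. **Auxiliary procedures.** - $separate(Edges,Separator)$: returns the set of components (each represented as a set of hyperedges) of the sub-hypergraph with hyperedge set $Edges$ with respect to the vertex set $\bigcup Separator$; i.e. for each connected component $C$ of $\bigcup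 Edges\setminus\bigcup Separator$ (connectivity via hyperedges of $Edges$, avoiding $\bigcup Separator$) it contains the set of those $e\in Edges$ with $e\cap C\ne\emptyset$. - $cover(Conn,BoundEdges)$: successively returns (without repetition) sets $CovSep\subseteq BoundEdges$ with $|CovSep|\le k$ and $Conn\subseteq\bigcup CovSep$, such that at least all inclusion-minimal such sets are returned (for $Conn=\emptyset$ this includes $CovSep=\emptyset$). - $getHTNode(\lambda,\chi,Subtrees)$: constructs a tree node with the given $\lambda$-label (a set of hyperedges), $\chi$-label (a set of vertices) and child subtrees. - $expand(HTree)$: replaces the pruned nodes created in step (a) of $decompSub$ below by the full subtrees already found for the corresponding components. **The algorithm det-$k$-decomp**, on input a hypergraph $H$. Global variables $FailSeps$ and $SuccSeps$ are initialized to $\emptyset$. Compute $HTree:=decompCov(edges(H),\emptyset)$; if $HTree\ne$ NULL, set $HTree:=expand(HTree)$; return $HTree$. The procedures are: $decompCov(Edges,Conn)$: If $|Edges|\le k$, return $getHTNode(Edges,\bigcup Edges,\emptyset)$. Otherwise let $BoundEdges:=\{e\in edges(H) : e\cap Conn\neq\emptyset\}$. For each $CovSep$ returned by $cover(Conn,BoundEdges)$: let $HTree:=decompAdd(Edges,Conn,CovSep)$; if $HTree\ne$ NULL return $HTree$. After the loop return NULL. $decompAdd(Edges,Conn,CovSep)$: Let $InCovSep:=CovSep\cap Edges$. If $InCovSep\ne\emptyset$ or $k-|CovSep|>0$: set $AddSize:=1$ if $InCovSep=\emptyset$ and $AddSize:=0$ otherwise; for each $AddSep\subseteq Edges$ with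 $|AddSep|=AddSize$: let $Separator:=CovSep\cup AddSep$ and $Components:=separate(Edges,Separator)$; if $\langle Separator,Comp\rangle\notin FailSeps$ for all $Comp\in Components$, then let $Subtrees:=decompSub(Components,Separator)$, and if this did not fail, let $Chi:=Conn\cup\bigcup(InCovSep\cup AddSep)$ and return $getHTNode(Separator,Chi,Subtrees)$. If nothing has been returned, return NULL. $decompSub(Components,Separator)$: Let $Subtrees:=\emptyset$. For each $Comp\in Components$: let $ChildConn:=\bigcup Comp\cap\bigcup Separator$. (a) If $\langle Separator,Comp\rangle\in SuccSeps$, let $HTree:=getHTNode(Comp,ChildConn,\emptyset)$ (a pruned node). (b) Otherwise let $HTree:=decompCov(Comp,ChildConn)$; if $HTree=$ NULL, add $\langle Separator,Comp\rangle$ to $FailSeps$ and return with failure; else add $\langle Separator,Comp\rangle$ to $SuccSeps$. In either non-failing case, add $HTree$ to $Subtrees$. After the loop return $Subtrees$ (success). -}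

module Defs where

open import Data.Bool.Base using (Bool; true; false; if_then_else_)
open import Data.Fin.Base using (Fin)
open import Data.Fin.Subset hiding (⋃)
open import Data.Fin.Subset.Induction using (⊂-wellFounded)
open import Data.Fin.Subset.Properties
open import Data.List.Base as List using (List; []; _∷_; filter; allFin)
open import Data.List.Extrema.Nat using (max)
open import Data.List.Membership.Propositional using (mapWith∈)
open import Data.List.Membership.Propositional.Properties using (∈-filter⁻)
open import Data.List.Relation.Unary.All as All using (All; []; _∷_)
import Data.List.Membership.DecPropositional as DecMembership
open import Data.Maybe.Base using (Maybe; just; nothing)
open import Data.Nat.Base using (ℕ; zero; suc; _+_)
open import Data.Nat.Properties using (_≤?_; _<?_)
open import Data.Product.Base using (∃; _×_; _,_; proj₁; proj₂)
open import Data.Product.Properties using () renaming (≡-dec to ×-≡-dec)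
open import Data.Sum.Base using (inj₁; inj₂)
open import Data.Unit.Base using () renaming (⊤ to Unit; tt to unit)
open import Data.Vec.Base using (Vec; lookup; replicate; tabulate; _[_]%=_)
open import Data.Vec.Properties using () renaming (≡-dec to Vec-≡-dec)
open import Data.Bool.Properties using () renaming (_≟_ to _≟ᵇ_)
open import Function.Base using (_∘_)
open import Function.Definitions using (Injective)
open import Induction.WellFounded using (Acc; acc)
open import Relation.Binary.Definitions using (DecidableEquality)
open import Relation.Binary.PropositionalEquality using (_≡_)
open import Relation.Nullary.Decidable using (Dec; yes; no; does)

-- A hypergraph with vertex set Fin m and n hyperedges.  Injectivity of edge
-- says that the hyperedges form a set.

record Hypergraph (m n : ℕ) : Set where
  field
    edge           : Fin n → Subset m
    edge-injective : Injective _≡_ _≡_ edge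
    edge-nonempty  : ∀ e → Nonempty (edge e)
    covered        : ∀ v → ∃ λ e → v ∈ edge e

module _ {m n} (H : Hypergraph m n) where
  open Hypergraph H

  incident : Fin n → Subset n
  incident e = tabulate λ f → does (nonempty? (edge e ∩ edge f))

  maxIncident : ℕ
  maxIncident = max 0 (List.map (∣_∣ ∘ incident) (allFin n))

-- Cost model.  A procedure returns its value together with the number of
-- elementary steps it takes.  An elementary step is one standard operation on
-- sets (of vertices, of hyperedges, or of pairs in FailSeps and SuccSeps):
-- union, intersection, difference, inserting, choosing an element,
-- cardinality, and deciding membership, inclusion or emptiness; reading or
-- writing one array cell; or making one tree node.  Running through the
-- elements of a set takes at least one step per element, in the order of Fin;
-- as the numbering of a hypergraph is arbitrary, so is this order.

record Timed (A : Set) : Set where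
  constructor _▹_
  field
    cost  : ℕ
    value : A
open Timed public

module T where
  return : ∀ {A} → A → Timed A
  return x = 0 ▹ x

  _>>=_ : ∀ {A B} → Timed A → (A → Timed B) → Timed B
  t >>= f = (cost t + cost (f (value t))) ▹ value (f (value t))

  _>>_ : ∀ {A B} → Timed A → Timed B → Timed B
  s >> t = s >>= λ _ → t

step : ∀ {A} → A → Timed A
step x = 1 ▹ x

tick : ℕ → Timed Unit
tick c = c ▹ unit

elements : ∀ {n} → Subset n → List (Fin n)
elements {n} p = filter (_∈? p) (allFin n)

_≟ˢ_ : ∀ {n} → DecidableEquality (Subset n)
_≟ˢ_ = Vec-≡-dec _≟ᵇ_

-- getHTNode λ-label χ-label subtrees

data HTree (m n : ℕ) : Set where
  getHTNode : Subset n → Subset m → List (HTree m n) → HTree m n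

-- The global variables; a pair consists of a separator and a component.

record Globals (n : ℕ) : Set where
  constructor globals
  field
    failSeps succSeps : List (Subset n × Subset n)
open Globals public

module _ {n : ℕ} where
  open DecMembership (×-≡-dec (_≟ˢ_ {n}) (_≟ˢ_ {n})) public
    using () renaming (_∈?_ to _∈ᵖ?_)

-- Timed procedures acting on the global variables.

Proc : ℕ → Set → Set
Proc n A = Globals n → Timed (A × Globals n)

module P {n : ℕ} where
  return : ∀ {A} → A → Proc n A
  return x g = 0 ▹ (x , g)

  _>>=_ : ∀ {A B} → Proc n A → (A → Proc n B) → Proc n B
  (p >>= f) g = p g T.>>= λ (x , g′) → f x g′

  _>>_ : ∀ {A B} → Proc n A → Proc n B → Proc n B
  p >> q = p >>= λ _ → q

module _ {n : ℕ} where
  lift : ∀ {A} → Timed A → Proc n A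
  lift t g = cost t ▹ (value t , g)

  inFailSeps inSuccSeps : Subset n → Subset n → Proc n Bool
  inFailSeps Sep Comp g = step (does ((Sep , Comp) ∈ᵖ? failSeps g) , g)
  inSuccSeps Sep Comp g = step (does ((Sep , Comp) ∈ᵖ? succSeps g) , g)

  addFailSep addSuccSep : Subset n → Subset n → Proc n Unit
  addFailSep Sep Comp (globals fs ss) = step (unit , globals ((Sep , Comp) ∷ fs) ss)
  addSuccSep Sep Comp (globals fs ss) = step (unit , globals fs ((Sep , Comp) ∷ ss))

module Algorithm {m n} (H : Hypergraph m n) (k : ℕ) where
  open Hypergraph H

  module _ where
    open T

    ⋃ˡ : List (Fin n) → Timed (Subset m)
    ⋃ˡ []       = step ⊥
    ⋃ˡ (e ∷ es) = do
      U ← ⋃ˡ es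
      step (edge e ∪ U)

    ⋃ : Subset n → Timed (Subset m)
    ⋃ S = ⋃ˡ (elements S)

    -- separate(Edges, Separator).  First an array is filled that holds, for each
    -- vertex v outside ⋃ Separator, the set of those e in Edges with v ∈ e.

    Index : Set
    Index = Vec (Subset n) m

    register : Fin n → List (Fin m) → Index → Timed Index
    register e []       I = step I
    register e (v ∷ vs) I = do
      I′ ← step (I [ v ]%= (_∪ ⁅ e ⁆))
      register e vs I′

    index : List (Fin n) → Subset m → Timed Index
    index []       W = do
      tick m
      step (replicate m ⊥)
    index (e ∷ es) W = do
      I ← index es W
      D ← step (edge e ─ W)
      register e (elements D) I

    -- grow completes one component by graph search.
    --   todo:    vertices whose hyperedges have not been looked at yet;
    --   reached: vertices known to be in the component or in ⋃ Separator;
    --   K:       hyperedges known to meet the component;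
    --   R:       hyperedges not yet assigned to a component.
    -- It returns the final K, R and todo.

    grow : Index → (todo : Subset m) → Acc _⊂_ todo →
           (reached : Subset m) (K R : Subset n) →
           Timed (Subset n × Subset n × Subset m)
    grow I todo (acc rs) reached K R with nonempty? (reached ∩ todo)
    ... | no  _       = do
      tick 2
      return (K , R , todo)
    ... | yes (v , v∈) = do
      tick 4
      N        ← step (lookup I v ∩ R)
      Y        ← ⋃ N
      reached′ ← step (reached ∪ Y)
      K′       ← step (K ∪ N)
      R′       ← step (R ─ N)
      grow I (todo - v) (rs (x∈p⇒p-x⊂p (p∩q⊆q reached todo v∈))) reached′ K′ R′

    components : Index → List (Fin m) → (todo : Subset m) (R : Subset n) →
                 Timed (List (Subset n))
    components I []       todo R = step []
    components I (v ∷ vs) todo R with v ∈? todo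
    ... | no  _ = do
      tick 1
      components I vs todo R
    ... | yes _ = do
      tick 3
      (K , R′ , todo′) ← grow I todo (⊂-wellFounded todo) ⁅ v ⁆ ⊥ R
      Ks ← components I vs todo′ R′
      step (K ∷ Ks)

    -- The hyperedges in Separator meet no component, so the search is over
    -- Edges ─ Separator.

    separate : Subset n → Subset n → Timed (List (Subset n))
    separate Edges Separator = do
      W    ← ⋃ Separator
      I    ← index (elements Edges) W
      U    ← ⋃ Edges
      V    ← step (U ─ W)
      todo ← step (∁ W)
      R    ← step (Edges ─ Separator)
      components I (elements V) todo R

    -- Used only for termination: every component is a proper subset of Edges.

    grow-⊆ : ∀ {Q} I todo a reached {K R} → K ⊆ Q → R ⊆ Q →
             let (K′ , R′ , _) = value (grow I todo a reached K R) in
             K′ ⊆ Q × R′ ⊆ Q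
    grow-⊆ I todo (acc rs) reached {K} {R} K⊆Q R⊆Q with nonempty? (reached ∩ todo)
    ... | no  _        = K⊆Q , R⊆Q
    ... | yes (v , v∈) = grow-⊆ I (todo - v)
      (rs (x∈p⇒p-x⊂p (p∩q⊆q reached todo v∈)))
      (reached ∪ value (⋃ (lookup I v ∩ R)))
      (p⊆r∧q⊆r⇒p∪q⊆r K⊆Q (R⊆Q ∘ p∩q⊆q (lookup I v) R))
      (R⊆Q ∘ p─q⊆p R (lookup I v ∩ R))
      where
      p⊆r∧q⊆r⇒p∪q⊆r : ∀ {p q r : Subset n} → p ⊆ r → q ⊆ r → p ∪ q ⊆ r
      p⊆r∧q⊆r⇒p∪q⊆r {p} {q} p⊆r q⊆r x∈ with x∈p∪q⁻ p q x∈
      ... | inj₁ x∈p = p⊆r x∈p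
      ... | inj₂ x∈q = q⊆r x∈q

    components-⊆ : ∀ {Q} I vs todo {R} → R ⊆ Q →
                   All (_⊆ Q) (value (components I vs todo R))
    components-⊆ I []       todo R⊆Q = []
    components-⊆ I (v ∷ vs) todo {R} R⊆Q with v ∈? todo
    ... | no  _ = components-⊆ I vs todo R⊆Q
    ... | yes _ = let K⊆Q , R′⊆Q = grow-⊆ I todo _ ⁅ v ⁆ {⊥} ⊥⊆ R⊆Q in
      K⊆Q ∷ components-⊆ I vs _ R′⊆Q

    separate-⊂ : ∀ Edges Separator → Nonempty (Edges ∩ Separator) →
                 All (_⊂ Edges) (value (separate Edges Separator))
    separate-⊂ Edges Separator ne =
      All.map smaller (components-⊆ (value (index (elements Edges) W))
        (elements (value (⋃ Edges) ─ W)) (∁ W) (⊆-refl {x = Edges ─ Separator}))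
      where
      W = value (⋃ Separator)

      smaller : ∀ {K} → K ⊆ Edges ─ Separator → K ⊂ Edges
      smaller {K} K⊆ = ⊆-⊂-trans {i = K} {j = Edges ─ Separator} {k = Edges}
        K⊆ (p∩q≢∅⇒p─q⊂p Edges Separator ne)

    separate⁺ : ∀ Edges Separator → Nonempty (Edges ∩ Separator) →
                Timed (∃ (All (_⊂ Edges)))
    separate⁺ Edges Separator ne =
      cost (separate Edges Separator) ▹
      (value (separate Edges Separator) , separate-⊂ Edges Separator ne)

    -- cover(Conn, BoundEdges) returns every subset of BoundEdges with at most k
    -- members that covers Conn.  In coverFrom, S consists of the hyperedges
    -- chosen so far, U is ⋃ S, j more may be chosen from the given list, and the
    -- covers found are put in front of found.

    emitIfCover : (Conn : Subset m) (S : Subset n) (U : Subset m) →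
                  List (Subset n) → Timed (List (Subset n))
    emitIfCover Conn S U found = step (if does (Conn ⊆? U) then S ∷ found else found)

    coverFrom : (j : ℕ) → List (Fin n) → (Conn : Subset m) (S : Subset n) (U : Subset m) →
                List (Subset n) → Timed (List (Subset n))
    coverFrom zero    es       Conn S U found = emitIfCover Conn S U found
    coverFrom (suc j) []       Conn S U found = emitIfCover Conn S U found
    coverFrom (suc j) (e ∷ es) Conn S U found = do
      found′ ← coverFrom (suc j) es Conn S U found
      S′     ← step (S ∪ ⁅ e ⁆)
      U′     ← step (U ∪ edge e)
      coverFrom j es Conn S′ U′ found′

    cover : (Conn : Subset m) (BoundEdges : Subset n) → Timed (List (Subset n))
    cover Conn BoundEdges = coverFrom k (elements BoundEdges) Conn ⊥ ⊥ []

    boundEdges : Subset m → List (Fin n) → Timed (Subset n)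
    boundEdges Conn []       = step ⊥
    boundEdges Conn (e ∷ es) = do
      B ← boundEdges Conn es
      X ← step (edge e ∩ Conn)
      b ← step (does (nonempty? X))
      if b then step (B ∪ ⁅ e ⁆) else return B

  module _ where
    open P

    -- rec stands for decompCov; it is only ever called on proper subsets of the
    -- current Edges.

    Rec : Subset n → Set
    Rec Edges = ∀ {Comp} → Comp ⊂ Edges → (Conn : Subset m) → Proc n (Maybe (HTree m n))

    decompSub : ∀ {Edges Comps} → Rec Edges → All (_⊂ Edges) Comps → (Separator : Subset n) →
                Proc n (Maybe (List (HTree m n)))
    decompSub rec []                    Separator = lift (step (just []))
    decompSub rec (_∷_ {Comp} lt Comps) Separator = do
      C         ← lift (⋃ Comp)
      W         ← lift (⋃ Separator)
      ChildConn ← lift (step (C ∩ W))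
      true ← inSuccSeps Separator Comp
        where false → do
                just tree ← rec lt ChildConn
                  where nothing → do
                          addFailSep Separator Comp
                          return nothing
                addSuccSep Separator Comp
                addSubtree tree
      tree ← lift (step (getHTNode Comp ChildConn []))
      addSubtree tree
      where
      addSubtree : HTree m n → Proc n (Maybe (List (HTree m n)))
      addSubtree tree = do
        just trees ← decompSub rec Comps Separator
          where nothing → return nothing
        lift (step (just (tree ∷ trees)))

    noneFailed : (Separator : Subset n) → List (Subset n) → Proc n Bool
    noneFailed Separator []             = lift (step true)
    noneFailed Separator (Comp ∷ Comps) = do
      false ← inFailSeps Separator Comp
        where true → return false
      noneFailed Separator Comps

    -- The choices for AddSep, each with a proof that Separator contains a member
    -- of Edges.

    AddSeps : (Edges CovSep : Subset n) → Set
    AddSeps Edges CovSep = List (∃ λ AddSep → Nonempty (Edges ∩ (CovSep ∪ AddSep)))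

    emptyAddSep : ∀ Edges CovSep → Nonempty (CovSep ∩ Edges) → AddSeps Edges CovSep
    emptyAddSep Edges CovSep (e , e∈) = List.[ ⊥ , e , x∈p∩q⁺ (e∈Edges , p⊆p∪q ⊥ e∈CovSep) ]
      where
      e∈CovSep = p∩q⊆p CovSep Edges e∈
      e∈Edges  = p∩q⊆q CovSep Edges e∈

    singletonAddSeps : ∀ Edges CovSep → AddSeps Edges CovSep
    singletonAddSeps Edges CovSep = mapWith∈ (elements Edges) λ {e} e∈ →
      ⁅ e ⁆ , e , x∈p∩q⁺ (proj₂ (∈-filter⁻ (_∈? Edges) {xs = allFin n} e∈) , q⊆p∪q CovSep ⁅ e ⁆ (x∈⁅x⁆ e))

    tryAddSeps : ∀ {Edges} → Rec Edges → (Conn : Subset m) (CovSep InCovSep : Subset n) →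
                 AddSeps Edges CovSep → Proc n (Maybe (HTree m n))
    tryAddSeps rec Conn CovSep InCovSep [] = lift (step nothing)
    tryAddSeps {Edges} rec Conn CovSep InCovSep ((AddSep , ne) ∷ rest) = do
      lift (tick 1)
      (Components , smaller) ← lift (separate⁺ Edges Separator ne)
      true ← noneFailed Separator Components
        where false → tryAddSeps rec Conn CovSep InCovSep rest
      just Subtrees ← decompSub rec smaller Separator
        where nothing → tryAddSeps rec Conn CovSep InCovSep rest
      S   ← lift (step (InCovSep ∪ AddSep))
      U   ← lift (⋃ S)
      Chi ← lift (step (Conn ∪ U))
      lift (step (just (getHTNode Separator Chi Subtrees)))
      where
      Separator = CovSep ∪ AddSep

    decompAdd : ∀ Edges → Rec Edges → (Conn : Subset m) (CovSep : Subset n) →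
                Proc n (Maybe (HTree m n))
    decompAdd Edges rec Conn CovSep with nonempty? (CovSep ∩ Edges) | ∣ CovSep ∣ <? k
    ... | yes ne | _     = do
      lift (tick 2)
      tryAddSeps rec Conn CovSep (CovSep ∩ Edges) (emptyAddSep Edges CovSep ne)
    ... | no  _  | yes _ = do
      lift (tick 4)
      tryAddSeps rec Conn CovSep (CovSep ∩ Edges) (singletonAddSeps Edges CovSep)
    ... | no  _  | no  _ = do
      lift (tick 4)
      return nothing

    tryCovSeps : ∀ Edges → Rec Edges → (Conn : Subset m) → List (Subset n) →
                 Proc n (Maybe (HTree m n))
    tryCovSeps Edges rec Conn []                 = lift (step nothing)
    tryCovSeps Edges rec Conn (CovSep ∷ CovSeps) = do
      nothing ← decompAdd Edges rec Conn CovSep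
        where just tree → return (just tree)
      tryCovSeps Edges rec Conn CovSeps

    decompCov : ∀ Edges → Acc _⊂_ Edges → (Conn : Subset m) → Proc n (Maybe (HTree m n))
    decompCov Edges (acc rs) Conn with ∣ Edges ∣ ≤? k
    ... | yes _ = do
      lift (tick 2)
      Chi ← lift (⋃ Edges)
      lift (step (just (getHTNode Edges Chi [])))
    ... | no  _ = do
      lift (tick 2)
      BoundEdges ← lift (boundEdges Conn (elements ⊤))
      CovSeps    ← lift (cover Conn BoundEdges)
      tryCovSeps Edges (λ {Comp} lt → decompCov Comp (rs lt)) Conn CovSeps

  module _ where
    open T

    -- The tree is returned before expand is applied to it, since the cost of
    -- expand is not counted.

    detKDecomp : Timed (Maybe (HTree m n))
    detKDecomp = do
      g           ← step (globals [] [])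
      (tree , _)  ← decompCov ⊤ (⊂-wellFounded ⊤) ⊥ g
      return tree

runningTime : ∀ {m n} → ℕ → Hypergraph m n → ℕ
runningTime k H = cost (Algorithm.detKDecomp H k)

{-# OPTIONS --safe #-}

-- The running time is bounded by amortisation.  Let M = min(n, ck) and B = A M^k m² with
-- A depending on k only.  A call of decompCov for a set E of more than k hyperedges
-- spends, apart from recursive calls, at most B |E| steps:  by Conn ⊆ ⋃ Separator there are
-- at most M boundary edges, hence O(M^k) covers, of which only O(M^(k-1)) have fewer than k
-- members and thus need |E| choices for AddSep; one choice costs O(m |E|); and
-- |E| ≤ n ≤ M m, since every vertex lies in at most c hyperedges.
--
-- In a call, E is closed under adjacency outside Conn ⊆ ⋃ Separator, so the components of E
-- with respect to Separator are components of the whole hypergraph.  Those recorded for one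
-- separator in FailSeps and SuccSeps are therefore pairwise disjoint, and no pair is evaluated
-- twice.  Hence the sum of |E| over all calls is at most n for each of the O(n^k) separators,
-- and the total cost is O(n^(k+1)) · B.

module Submission where

open import Defs

open import Data.Bool.Base using (true; false)
open import Data.Fin.Base using (Fin; zero; suc; fromℕ<)
open import Data.Fin.Subset hiding (⋃)
open import Data.Fin.Subset.Properties
open import Data.Fin.Subset.Induction using (⊂-wellFounded)
import Data.Fin.Properties as Fin
open import Data.List.Base as List using (List; []; _∷_; _++_; allFin; map; length)
open import Data.List.Extrema.Nat using (xs≤max)
open import Data.List.Membership.Propositional using (mapWith∈) renaming (_∈_ to _∈ˡ_; _∉_ to _∉ˡ_)
open import Data.List.Membership.Setoid.Properties using (length-mapWith∈)
open import Data.List.Membership.Propositional.Properties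
  using (∈-filter⁺; ∈-filter⁻; ∈-allFin; ∈-map⁺; ∈-++⁺ˡ; ∈-++⁺ʳ)
open import Data.List.Properties using (length-map; length-++; length-tabulate)
open import Data.List.Relation.Unary.All as All using (All; []; _∷_)
open import Data.List.Relation.Unary.Any using (here; there)
open import Data.List.Relation.Unary.AllPairs using ([]; _∷_)
open import Data.List.Relation.Unary.Unique.Propositional using (Unique)
open import Data.List.Relation.Unary.Unique.Propositional.Properties using (allFin⁺; filter⁺)
open import Data.Maybe.Base using (just; nothing)
open import Data.Nat.Base using (ℕ; zero; suc; _+_; _*_; _^_; _⊓_; _≤_; _<_; z≤n; s≤s; >-nonZero)
open import Data.Nat.ListAction using (sum)
open import Data.Nat.Properties
open import Data.Nat.Tactic.RingSolver using (solve-∀)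
open import Data.Product.Base using (∃; ∃-syntax; _×_; _,_; proj₁; proj₂)
open import Data.Sum.Base using (_⊎_; inj₁; inj₂; [_,_]′; map₁)
open import Data.Vec.Base using ([]; _∷_; lookup; tabulate; _[_]%=_)
import Data.Vec.Properties as Vec
import Data.Vec.Base as Vec
open import Function.Base using (_∘_; id)
open import Induction.WellFounded using (acc)
open import Relation.Binary.PropositionalEquality
open import Relation.Nullary.Decidable using (Dec; yes; no; does; dec-true)
open import Relation.Nullary.Negation using (¬_; contradiction)

private variable
  n : ℕ

-- Cardinalities of finite subsets and their element lists.

x∈p─q⇒x∉q : ∀ {p q : Subset n} {x} → x ∈ p ─ q → x ∉ q
x∈p─q⇒x∉q {p = _ ∷ _} {outside ∷ _} {zero}  _          ()
x∈p─q⇒x∉q {p = _ ∷ _} {inside  ∷ _} {zero}  ()         _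
x∈p─q⇒x∉q {p = _ ∷ p} {outside ∷ q} {suc x} (Vec.there x∈) (Vec.there x∈q) = x∈p─q⇒x∉q {p = p} {q} x∈ x∈q
x∈p─q⇒x∉q {p = _ ∷ p} {inside  ∷ q} {suc x} (Vec.there x∈) (Vec.there x∈q) = x∈p─q⇒x∉q {p = p} {q} x∈ x∈q

∣p∪q∣≤∣p∣+∣q∣ : ∀ (p q : Subset n) → ∣ p ∪ q ∣ ≤ ∣ p ∣ + ∣ q ∣
∣p∪q∣≤∣p∣+∣q∣ []            []            = z≤n
∣p∪q∣≤∣p∣+∣q∣ (outside ∷ p) (outside ∷ q) = ∣p∪q∣≤∣p∣+∣q∣ p q
∣p∪q∣≤∣p∣+∣q∣ (outside ∷ p) (inside  ∷ q) = ≤-trans (s≤s (∣p∪q∣≤∣p∣+∣q∣ p q)) (≤-reflexive (sym (+-suc ∣ p ∣ ∣ q ∣)))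
∣p∪q∣≤∣p∣+∣q∣ (inside  ∷ p) (outside ∷ q) = s≤s (∣p∪q∣≤∣p∣+∣q∣ p q)
∣p∪q∣≤∣p∣+∣q∣ (inside  ∷ p) (inside  ∷ q) = s≤s (≤-trans (∣p∪q∣≤∣p∣+∣q∣ p q) (+-monoʳ-≤ ∣ p ∣ (n≤1+n ∣ q ∣)))

disjoint⇒∣p∣+∣q∣≤∣r∣ : ∀ {p q r : Subset n} → p ⊆ r → q ⊆ r → (∀ {x} → x ∈ p → x ∉ q) →
                     ∣ p ∣ + ∣ q ∣ ≤ ∣ r ∣
disjoint⇒∣p∣+∣q∣≤∣r∣ {p = []} {[]} {[]} _ _ _ = z≤n
disjoint⇒∣p∣+∣q∣≤∣r∣ {p = s ∷ p} {t ∷ q} {u ∷ r} p⊆r q⊆r disj = go s t u p⊆r q⊆r disj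
  where
  ih = disjoint⇒∣p∣+∣q∣≤∣r∣ (drop-∷-⊆ p⊆r) (drop-∷-⊆ q⊆r) (λ x∈p x∈q → disj (Vec.there x∈p) (Vec.there x∈q))
  go : ∀ s t u → s ∷ p ⊆ u ∷ r → t ∷ q ⊆ u ∷ r → (∀ {x} → x ∈ s ∷ p → x ∉ t ∷ q) →
       ∣ s ∷ p ∣ + ∣ t ∷ q ∣ ≤ ∣ u ∷ r ∣
  go inside  inside  _       _ _ d = contradiction Vec.here (d Vec.here)
  go inside  outside inside  _ _ _ = s≤s ih
  go inside  outside outside s _ _ = contradiction (s Vec.here) λ ()
  go outside inside  inside  _ _ _ = ≤-trans (≤-reflexive (+-suc ∣ p ∣ ∣ q ∣)) (s≤s ih)
  go outside inside  outside _ t _ = contradiction (t Vec.here) λ ()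
  go outside outside outside _ _ _ = ih
  go outside outside inside  _ _ _ = m≤n⇒m≤1+n ih

∈-elements⁻ : ∀ {p : Subset n} {x} → x ∈ˡ elements p → x ∈ p
∈-elements⁻ {p = p} x∈ = proj₂ (∈-filter⁻ (_∈? p) {xs = allFin _} x∈)

∈-elements⁺ : ∀ {p : Subset n} {x} → x ∈ p → x ∈ˡ elements p
∈-elements⁺ {p = p} {x} x∈ = ∈-filter⁺ (_∈? p) (∈-allFin x) x∈

elements-unique : ∀ (p : Subset n) → Unique (elements p)
elements-unique p = filter⁺ (_∈? p) (allFin⁺ _)

unique⇒length≤ : ∀ {p : Subset n} {xs} → Unique xs → All (_∈ p) xs → length xs ≤ ∣ p ∣
unique⇒length≤ [] [] = z≤n
unique⇒length≤ {p = p} (x# ∷ u) (x∈ ∷ all) = ≤-trans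
  (s≤s (unique⇒length≤ u (All.zipWith (λ (x≢y , y∈) → x∈p∧x≢y⇒x∈p-y y∈ (x≢y ∘ sym)) (x# , all))))
  (x∈p⇒∣p-x∣<∣p∣ x∈)

length-elements : ∀ (p : Subset n) → length (elements p) ≤ ∣ p ∣
length-elements p = unique⇒length≤ (elements-unique p) (All.tabulate ∈-elements⁻)

-- A union bound: what is left of `p` after peeling off `f x` is covered by the later values of `f`.
-- With incident hyperedges for `f`, it bounds both the boundary edges and `n` itself.
∣p∣≤length*c : ∀ {A : Set} {c} (f : A → Subset n) xs {p : Subset n} →
  (∀ {e} → e ∈ p → ∃ λ x → x ∈ˡ xs × e ∈ f x) → (∀ x → ∣ f x ∣ ≤ c) → ∣ p ∣ ≤ length xs * c
∣p∣≤length*c {n = n} f [] cov _ = ≤-reflexive (trans (cong ∣_∣ (Empty-unique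
  λ (_ , e∈) → contradiction (proj₁ (proj₂ (cov e∈))) λ ())) (∣⊥∣≡0 n))
∣p∣≤length*c {c = c} f (x ∷ xs) {p} cov bnd = begin
  ∣ p ∣                   ≤⟨ p⊆q⇒∣p∣≤∣q∣ split ⟩
  ∣ f x ∪ (p ─ f x) ∣     ≤⟨ ∣p∪q∣≤∣p∣+∣q∣ (f x) (p ─ f x) ⟩
  ∣ f x ∣ + ∣ p ─ f x ∣   ≤⟨ +-mono-≤ (bnd x) (∣p∣≤length*c f xs rest bnd) ⟩
  c + length xs * c       ∎
  where
  open ≤-Reasoning
  split : p ⊆ f x ∪ (p ─ f x)
  split {e} e∈ with e ∈? f x
  ... | yes e∈f = p⊆p∪q _ e∈f
  ... | no  e∉f = q⊆p∪q (f x) _ (x∈p∧x∉q⇒x∈p─q e∈ e∉f)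
  rest : ∀ {e} → e ∈ p ─ f x → ∃ λ y → y ∈ˡ xs × e ∈ f y
  rest e∈ with cov (p─q⊆p p (f x) e∈)
  ... | y , here refl , e∈f = contradiction e∈f (x∈p─q⇒x∉q {p = p} e∈)
  ... | y , there y∈  , e∈f = y , y∈ , e∈f

does-true⇒∈tabulate : ∀ {P : Fin n → Set} (P? : ∀ x → Dec (P x)) {x} → P x → x ∈ tabulate (does ∘ P?)
does-true⇒∈tabulate P? {x} px = Vec.lookup⇒[]= x _ (trans (Vec.lookup∘tabulate (does ∘ P?) x) (dec-true (P? x) px))

-- Counting small subsets, and sums over lists.

smallSubsets : ∀ n → ℕ → List (Subset n)
smallSubsets zero    j       = List.[ [] ]
smallSubsets (suc n) zero    = map (outside ∷_) (smallSubsets n zero)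
smallSubsets (suc n) (suc j) = map (outside ∷_) (smallSubsets n (suc j)) ++ map (inside ∷_) (smallSubsets n j)

∈-smallSubsets : ∀ {j} (p : Subset n) → ∣ p ∣ ≤ j → p ∈ˡ smallSubsets n j
∈-smallSubsets                   []            _         = here refl
∈-smallSubsets {j = zero}        (outside ∷ p) le        = ∈-map⁺ (outside ∷_) (∈-smallSubsets p le)
∈-smallSubsets {j = suc j}       (outside ∷ p) le        = ∈-++⁺ˡ (∈-map⁺ (outside ∷_) (∈-smallSubsets p le))
∈-smallSubsets {suc n} {suc j}   (inside ∷ p)  (s≤s le)  =
  ∈-++⁺ʳ (map (outside ∷_) (smallSubsets n (suc j))) (∈-map⁺ (inside ∷_) (∈-smallSubsets p le))

pascal-bound : ∀ n j → suc n ^ suc j + suc n ^ j ≤ suc (suc n) ^ suc j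
pascal-bound n j = begin
  suc n * suc n ^ j + suc n ^ j       ≡⟨ +-comm (suc n * suc n ^ j) _ ⟩
  suc (suc n) * suc n ^ j             ≤⟨ *-monoʳ-≤ (suc (suc n)) (^-monoˡ-≤ j (n≤1+n (suc n))) ⟩
  suc (suc n) * suc (suc n) ^ j       ∎
  where open ≤-Reasoning

-- Choosing at most `j` members is like choosing `j` times among the elements and a blank, whence
-- the base `suc n`; the proof follows Pascal's recursion.
length-smallSubsets : ∀ n j → length (smallSubsets n j) ≤ suc n ^ j
length-smallSubsets zero    j    = m^n>0 1 j
length-smallSubsets (suc n) zero = ≤-trans (≤-reflexive (length-map _ (smallSubsets n zero))) (length-smallSubsets n zero)
length-smallSubsets (suc n) (suc j) = begin
  length (smallSubsets (suc n) (suc j))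
    ≡⟨ length-++ (map (outside ∷_) (smallSubsets n (suc j))) ⟩
  length (map (outside ∷_) (smallSubsets n (suc j))) + length (map (inside ∷_) (smallSubsets n j))
    ≡⟨ cong₂ _+_ (length-map _ (smallSubsets n (suc j))) (length-map _ (smallSubsets n j)) ⟩
  length (smallSubsets n (suc j)) + length (smallSubsets n j)
    ≤⟨ +-mono-≤ (length-smallSubsets n (suc j)) (length-smallSubsets n j) ⟩
  suc n ^ suc j + suc n ^ j
    ≤⟨ pascal-bound n j ⟩
  suc (suc n) ^ suc j ∎
  where open ≤-Reasoning

sum-map-mono : ∀ {A : Set} {f g : A → ℕ} xs → (∀ x → f x ≤ g x) → sum (map f xs) ≤ sum (map g xs)
sum-map-mono []       _   = z≤n
sum-map-mono (x ∷ xs) f≤g = +-mono-≤ (f≤g x) (sum-map-mono xs f≤g)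

-- In this form the fall of a single separator's term becomes a fall of the whole potential.
sum-map-drop : ∀ {A : Set} {f g : A → ℕ} {x xs d} → x ∈ˡ xs → (∀ y → f y ≤ g y) → f x + d ≤ g x →
               sum (map f xs) + d ≤ sum (map g xs)
sum-map-drop {f = f} {g} {xs = x ∷ xs} {d} (here refl) f≤g drop = begin
  f x + sum (map f xs) + d    ≡⟨ +-assoc (f x) _ d ⟩
  f x + (sum (map f xs) + d)  ≡⟨ cong (f x +_) (+-comm _ d) ⟩
  f x + (d + sum (map f xs))  ≡⟨ +-assoc (f x) d _ ⟨
  f x + d + sum (map f xs)    ≤⟨ +-mono-≤ drop (sum-map-mono xs f≤g) ⟩
  g x + sum (map g xs)        ∎
  where open ≤-Reasoning
sum-map-drop {f = f} {xs = y ∷ xs} {d} (there x∈) f≤g drop =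
  ≤-trans (≤-reflexive (+-assoc (f y) _ d)) (+-mono-≤ (f≤g y) (sum-map-drop x∈ f≤g drop))

sum-map≤length* : ∀ {A : Set} {f : A → ℕ} {c} xs → (∀ x → f x ≤ c) → sum (map f xs) ≤ length xs * c
sum-map≤length* []       _   = z≤n
sum-map≤length* (x ∷ xs) f≤c = +-mono-≤ (f≤c x) (sum-map≤length* xs f≤c)

-- Components outside a vertex set, and the correctness and cost of the search for them.

module Separation {m n} (H : Hypergraph m n) (k : ℕ) where
  open Hypergraph H
  open Algorithm H k

  ⋃ᵛ : Subset n → Subset m
  ⋃ᵛ S = value (⋃ S)

  ∈-⋃ˡ⁻ : ∀ es {u} → u ∈ value (⋃ˡ es) → ∃ λ e → e ∈ˡ es × u ∈ edge e
  ∈-⋃ˡ⁻ []       u∈ = contradiction u∈ ∉⊥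
  ∈-⋃ˡ⁻ (e ∷ es) u∈ with x∈p∪q⁻ (edge e) (value (⋃ˡ es)) u∈
  ... | inj₁ u∈e = e , here refl , u∈e
  ... | inj₂ u∈U = let f , f∈ , u∈f = ∈-⋃ˡ⁻ es u∈U in f , there f∈ , u∈f

  ∈-⋃ˡ⁺ : ∀ {es e u} → e ∈ˡ es → u ∈ edge e → u ∈ value (⋃ˡ es)
  ∈-⋃ˡ⁺ {e ∷ es} (here refl) u∈ = p⊆p∪q _ u∈
  ∈-⋃ˡ⁺ {e ∷ es} (there e∈)  u∈ = q⊆p∪q (edge e) _ (∈-⋃ˡ⁺ e∈ u∈)

  ∈-⋃⁻ : ∀ {S u} → u ∈ ⋃ᵛ S → ∃ λ e → e ∈ S × u ∈ edge e
  ∈-⋃⁻ {S} u∈ = let e , e∈ , u∈e = ∈-⋃ˡ⁻ (elements S) u∈ in e , ∈-elements⁻ e∈ , u∈e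

  ∈-⋃⁺ : ∀ {S e u} → e ∈ S → u ∈ edge e → u ∈ ⋃ᵛ S
  ∈-⋃⁺ e∈ = ∈-⋃ˡ⁺ (∈-elements⁺ e∈)

  cost-⋃ˡ : ∀ es → cost (⋃ˡ es) ≡ suc (length es)
  cost-⋃ˡ []       = refl
  cost-⋃ˡ (e ∷ es) = trans (+-comm _ 1) (cong suc (cost-⋃ˡ es))

  cost-⋃ : ∀ S → cost (⋃ S) ≤ suc ∣ S ∣
  cost-⋃ S = ≤-trans (≤-reflexive (cost-⋃ˡ (elements S))) (s≤s (length-elements S))

  -- Membership in a closed L is constant along paths avoiding W, so [W]-connectedness
  -- of K amounts to lying inside or outside every closed L; no paths are needed.

  Closed : Subset m → Subset n → Set
  Closed W L = ∀ {e f u} → u ∈ edge e → u ∈ edge f → u ∉ W → e ∈ L → f ∈ L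

  Disjoint : Subset n → Subset n → Set
  Disjoint K L = ∀ {e} → e ∈ K → e ∉ L

  -- Taken in the whole hypergraph rather than in `Edges`, so that components found in different
  -- calls can be compared. `K` may be empty; uniqueness and freshness below therefore start from a
  -- hyperedge of `K`.
  Component : Subset m → Subset n → Set
  Component W K = Closed W K × (∀ L → Closed W L → K ⊆ L ⊎ Disjoint K L)

  -- Each set is closed, so the other lies inside it or misses it; the common hyperedge excludes the
  -- latter.
  component-unique : ∀ {W K K′ e} → Component W K → Component W K′ → e ∈ K → e ∈ K′ → K ≡ K′
  component-unique {K = K} {K′} (cl , conn) (cl′ , conn′) e∈K e∈K′ =
    ⊆-antisym (within (conn K′ cl′) e∈K e∈K′) (within (conn′ K cl) e∈K′ e∈K)
    where
    within : ∀ {K L e} → K ⊆ L ⊎ Disjoint K L → e ∈ K → e ∈ L → K ⊆ L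
    within (inj₁ K⊆L)  _  _  = K⊆L
    within (inj₂ disj) e∈ e∈L = contradiction e∈L (disj e∈)

  -- Sharing a vertex outside `W` is symmetric. Hence a search can be confined to `L` or to its
  -- complement by one and the same argument.
  closed-∁ : ∀ {W L} → Closed W L → Closed W (∁ L)
  closed-∁ {L = L} cl u∈e u∈f u∉W e∈ = x∉p⇒x∈∁p λ f∈L → x∈∁p⇒x∉p e∈ (cl u∈f u∈e u∉W f∈L)

  Indexes : Index → (Fin m → Fin n → Set) → Set
  Indexes I P = (∀ {v e} → e ∈ lookup I v → P v e) × (∀ {v e} → P v e → e ∈ lookup I v)

  register-indexes : ∀ {e D P} I vs → (∀ {v} → v ∈ˡ vs → v ∈ D) → (∀ {v} → v ∈ D → v ∈ˡ vs) → Indexes I P →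
    Indexes (value (register e vs I)) (λ v f → (v ∈ D × f ≡ e) ⊎ P v f)
  register-indexes {e} {D} {P} I vs vs⊆D D⊆vs (sound , complete) =
    (λ f∈ → [ (λ (v∈ , eq) → inj₁ (vs⊆D v∈ , eq)) , inj₂ ∘ sound ]′ (sound′ vs I f∈)) ,
    [ (λ (v∈ , eq) → completeᵉ vs I (D⊆vs v∈) eq) , (λ p → keep vs I (complete p)) ]′
    where
    add : Subset n → Subset n
    add = _∪ ⁅ e ⁆
    upd : ∀ (I : Index) v → lookup (I [ v ]%= add) v ≡ lookup I v ∪ ⁅ e ⁆
    upd I v = Vec.lookup∘updateAt v I
    other : ∀ (I : Index) {v w} → w ≢ v → lookup (I [ v ]%= add) w ≡ lookup I w
    other I {v} {w} ne = Vec.lookup∘updateAt′ w v ne I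
    keep₁ : ∀ I v {w f} → f ∈ lookup I w → f ∈ lookup (I [ v ]%= add) w
    keep₁ I v {w} f∈ with w Fin.≟ v
    ... | yes refl = subst (_ ∈_) (sym (upd I v)) (p⊆p∪q _ f∈)
    ... | no  ne   = subst (_ ∈_) (sym (other I ne)) f∈
    keep : ∀ vs I {w f} → f ∈ lookup I w → f ∈ lookup (value (register e vs I)) w
    keep []       I f∈ = f∈
    keep (v ∷ vs) I f∈ = keep vs (I [ v ]%= add) (keep₁ I v f∈)
    completeᵉ : ∀ vs I {w f} → w ∈ˡ vs → f ≡ e → f ∈ lookup (value (register e vs I)) w
    completeᵉ (v ∷ vs) I (here refl) refl =
      keep vs (I [ v ]%= add) (subst (e ∈_) (sym (upd I v)) (q⊆p∪q (lookup I v) _ (x∈⁅x⁆ e)))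
    completeᵉ (v ∷ vs) I (there w∈) eq = completeᵉ vs (I [ v ]%= add) w∈ eq
    sound′ : ∀ vs I {w f} → f ∈ lookup (value (register e vs I)) w → (w ∈ˡ vs × f ≡ e) ⊎ f ∈ lookup I w
    sound′ []       I f∈ = inj₂ f∈
    sound′ (v ∷ vs) I {w} f∈ with sound′ vs (I [ v ]%= add) f∈
    ... | inj₁ (w∈ , eq) = inj₁ (there w∈ , eq)
    ... | inj₂ f∈′ with w Fin.≟ v
    ...   | no  ne   = inj₂ (subst (_ ∈_) (other I ne) f∈′)
    ...   | yes refl with x∈p∪q⁻ (lookup I v) ⁅ e ⁆ (subst (_ ∈_) (upd I v) f∈′)
    ...     | inj₁ f∈I = inj₂ f∈I
    ...     | inj₂ f∈e = inj₁ (here refl , x∈⁅y⁆⇒x≡y e f∈e)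

  index-indexes : ∀ es W → Indexes (value (index es W)) (λ v e → e ∈ˡ es × v ∈ edge e × v ∉ W)
  index-indexes []       W = (λ {v} e∈ → contradiction (subst (_ ∈_) (Vec.lookup-replicate v ⊥) e∈) ∉⊥) , λ ()
  index-indexes (e ∷ es) W = fwd , bwd
    where
    reg = register-indexes {e} {edge e ─ W} (value (index es W)) (elements (edge e ─ W)) ∈-elements⁻ ∈-elements⁺
                           (index-indexes es W)
    fwd : ∀ {v f} → f ∈ lookup (value (index (e ∷ es) W)) v → f ∈ˡ e ∷ es × v ∈ edge f × v ∉ W
    fwd f∈ with proj₁ reg f∈
    ... | inj₁ (v∈ , refl) = here refl , p─q⊆p (edge e) W v∈ , x∈p─q⇒x∉q {p = edge e} v∈
    ... | inj₂ (f∈ , rest) = there f∈ , rest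
    bwd : ∀ {v f} → f ∈ˡ e ∷ es × v ∈ edge f × v ∉ W → f ∈ lookup (value (index (e ∷ es) W)) v
    bwd (here refl , v∈ , v∉) = proj₂ reg (inj₁ (x∈p∧x∉q⇒x∈p─q v∈ v∉ , refl))
    bwd (there f∈  , rest)    = proj₂ reg (inj₂ (f∈ , rest))

  cost-register : ∀ e vs I → cost (register e vs I) ≡ suc (length vs)
  cost-register e []       I = refl
  cost-register e (v ∷ vs) I = cong suc (cost-register e vs (I [ v ]%= (_∪ ⁅ e ⁆)))

  cost-index : ∀ es W → cost (index es W) ≤ length es * (m + 2) + suc m
  cost-index []       W = ≤-reflexive (+-comm m 1)
  cost-index (e ∷ es) W = begin
    cost (index es W) + (1 + cost (register e (elements (edge e ─ W)) (value (index es W))))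
      ≤⟨ +-mono-≤ (cost-index es W) (s≤s (≤-trans (≤-reflexive (cost-register e (elements (edge e ─ W)) _))
           (s≤s (≤-trans (length-elements (edge e ─ W)) (∣p∣≤n (edge e ─ W)))))) ⟩
    length es * (m + 2) + suc m + (2 + m) ≡⟨ shuffle (length es * (m + 2)) m ⟩
    m + 2 + length es * (m + 2) + suc m ∎
    where
    open ≤-Reasoning
    shuffle : ∀ x m → x + suc m + (2 + m) ≡ m + 2 + x + suc m
    shuffle = solve-∀

  module _ {Edges : Subset n} {W : Subset m} (I : Index)
           (I-indexes : Indexes I λ v e → e ∈ Edges × v ∈ edge e × v ∉ W) where

    Exhausted : Subset m → Subset n → Set
    Exhausted todo R = (∀ {u} → u ∈ todo → u ∉ W) × (∀ {u e} → u ∉ W → u ∉ todo → e ∈ R → u ∉ edge e)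

    -- The loop invariant of `grow`; `R₀` holds the hyperedges that were unassigned when the current
    -- search began.
    record Search (R₀ : Subset n) (todo reached : Subset m) (K R : Subset n) : Set where
      field
        K⊆        : K ⊆ R₀
        R⊆        : R ⊆ R₀
        split     : ∀ {e} → e ∈ R₀ → e ∈ K ⊎ e ∈ R
        disjoint  : Disjoint K R
        K-reached : ∀ {e u} → e ∈ K → u ∈ edge e → u ∈ reached
        exhausted : Exhausted todo R
    open Search

    -- The side condition on reached vertices makes the property inductive: the hyperedges added
    -- next pass through such a vertex, so they stay in `L`.
    Confined : Subset n → Subset m → Subset n → Set
    Confined L reached K = K ⊆ L × (∀ {u e} → u ∈ reached → u ∉ W → u ∈ edge e → e ∈ L)

    module Step {R₀ todo reached K R} (R₀⊆Edges : R₀ ⊆ Edges) (s : Search R₀ todo reached K R)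
                v (v∈ : v ∈ reached ∩ todo) where
      N  = lookup I v ∩ R
      K′ = K ∪ N
      R′ = R ─ N
      reached′ = reached ∪ ⋃ᵛ N
      todo′ = todo - v

      v∉W : v ∉ W
      v∉W = proj₁ (exhausted s) (p∩q⊆q reached todo v∈)

      search : Search R₀ todo′ reached′ K′ R′
      K⊆ search e∈ = [ K⊆ s , R⊆ s ∘ p∩q⊆q (lookup I v) R ]′ (x∈p∪q⁻ K N e∈)
      R⊆ search e∈ = R⊆ s (p─q⊆p R N e∈)
      split search {e} e∈ with split s e∈ | e ∈? N
      ... | inj₁ e∈K | _      = inj₁ (p⊆p∪q N e∈K)
      ... | inj₂ _   | yes e∈N = inj₁ (q⊆p∪q K N e∈N)
      ... | inj₂ e∈R | no e∉N  = inj₂ (x∈p∧x∉q⇒x∈p─q e∈R e∉N)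
      disjoint search e∈ e∈R′ with x∈p∪q⁻ K N e∈
      ... | inj₁ e∈K = disjoint s e∈K (p─q⊆p R N e∈R′)
      ... | inj₂ e∈N = x∈p─q⇒x∉q {p = R} e∈R′ e∈N
      K-reached search e∈ u∈ with x∈p∪q⁻ K N e∈
      ... | inj₁ e∈K = p⊆p∪q _ (K-reached s e∈K u∈)
      ... | inj₂ e∈N = q⊆p∪q reached _ (∈-⋃⁺ e∈N u∈)
      proj₁ (exhausted search) u∈ = proj₁ (exhausted s) (p─q⊆p todo ⁅ v ⁆ u∈)
      proj₂ (exhausted search) {u} {e} u∉W u∉todo′ e∈R′ u∈e with u Fin.≟ v
      -- A hyperedge of `R′` through `v` would be indexed at `v` and hence lie in `N`, which has
      -- just been removed.
      ... | yes refl = x∈p─q⇒x∉q {p = R} e∈R′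
        (x∈p∩q⁺ (proj₂ I-indexes (R₀⊆Edges (R⊆ search e∈R′) , u∈e , u∉W) , p─q⊆p R N e∈R′))
      ... | no u≢v = proj₂ (exhausted s) u∉W (λ u∈ → u∉todo′ (x∈p∧x≢y⇒x∈p-y u∈ u≢v)) (p─q⊆p R N e∈R′) u∈e

      confined : ∀ {L} → Closed W L → Confined L reached K → Confined L reached′ K′
      confined {L} cl (K⊆L , at) = (λ e∈ → [ K⊆L , N⊆L ]′ (x∈p∪q⁻ K N e∈)) , at′
        where
        N⊆L : N ⊆ L
        N⊆L e∈ = at (p∩q⊆p reached todo v∈) v∉W (proj₁ (proj₂ (proj₁ I-indexes (p∩q⊆p (lookup I v) R e∈))))
        at′ : ∀ {u e} → u ∈ reached′ → u ∉ W → u ∈ edge e → e ∈ L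
        at′ u∈ u∉W u∈e with x∈p∪q⁻ reached (⋃ᵛ N) u∈
        ... | inj₁ u∈r = at u∈r u∉W u∈e
        ... | inj₂ u∈N = let f , f∈N , u∈f = ∈-⋃⁻ u∈N in cl u∈f u∈e u∉W (N⊆L f∈N)

    record Grown (R₀ K R : Subset n) (todo : Subset m) : Set where
      field
        R-closed    : Closed W R
        R-sub       : R ⊆ R₀
        K-component : Component W K
        K+R         : ∣ K ∣ + ∣ R ∣ ≤ ∣ R₀ ∣
        todo-done   : Exhausted todo R

    grow-spec : ∀ {R₀} todo a reached {K R} → R₀ ⊆ Edges → Closed W R₀ → Search R₀ todo reached K R →
                (∀ L → Closed W L → Confined L reached K ⊎ Confined (∁ L) reached K) →
                let (K′ , R′ , todo′) = value (grow I todo a reached K R) in Grown R₀ K′ R′ todo′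
    grow-spec {R₀} todo (acc rs) reached {K} {R} R₀⊆ cl s conf with nonempty? (reached ∩ todo)
    ... | yes (v , v∈) = grow-spec _ (rs (x∈p⇒p-x⊂p (p∩q⊆q reached todo v∈))) _ R₀⊆ cl search
            (λ L clL → [ inj₁ ∘ confined {L} clL , inj₂ ∘ confined {∁ L} (closed-∁ {L = L} clL) ]′ (conf L clL))
      where open Step R₀⊆ s v v∈
    ... | no none = record
      { R-closed    = R-cl
      ; R-sub       = R⊆ s
      ; K-component = K-cl , inside-or-outside
      ; K+R         = disjoint⇒∣p∣+∣q∣≤∣r∣ (K⊆ s) (R⊆ s) (disjoint s)
      ; todo-done   = exhausted s
      }
      where
      inside-or-outside : ∀ L → Closed W L → K ⊆ L ⊎ Disjoint K L
      inside-or-outside L clL with conf L clL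
      ... | inj₁ (K⊆L , _)  = inj₁ K⊆L
      ... | inj₂ (K⊆∁L , _) = inj₂ λ e∈ → x∈∁p⇒x∉p (K⊆∁L e∈)
      apart : ∀ {e f u} → u ∈ edge e → u ∈ edge f → u ∉ W → e ∈ K → f ∉ R
      apart u∈e u∈f u∉W e∈K f∈R =
        proj₂ (exhausted s) u∉W (λ u∈ → none (_ , x∈p∩q⁺ (K-reached s e∈K u∈e , u∈))) f∈R u∈f
      K-cl : Closed W K
      K-cl u∈e u∈f u∉W e∈K with split s (cl u∈e u∈f u∉W (K⊆ s e∈K))
      ... | inj₁ f∈K = f∈K
      ... | inj₂ f∈R = contradiction f∈R (apart u∈e u∈f u∉W e∈K)
      R-cl : Closed W R
      R-cl u∈e u∈f u∉W e∈R with split s (cl u∈e u∈f u∉W (R⊆ s e∈R))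
      ... | inj₁ f∈K = contradiction e∈R (apart u∈f u∈e u∉W f∈K)
      ... | inj₂ f∈R = f∈R

    -- Any one hyperedge through `v` decides the side, since closedness drags along all others
    -- through `v`.
    confined-root : ∀ v → v ∉ W → ∀ L → Closed W L → Confined L ⁅ v ⁆ ⊥ ⊎ Confined (∁ L) ⁅ v ⁆ ⊥
    confined-root v v∉W L cl with covered v
    ... | e , v∈e with e ∈? L
    ...   | yes e∈L = inj₁ ((λ x → contradiction x ∉⊥) , λ u∈ _ u∈f →
      cl v∈e (subst (_∈ edge _) (x∈⁅y⁆⇒x≡y v u∈) u∈f) v∉W e∈L)
    ...   | no  e∉L = inj₂ ((λ x → contradiction x ∉⊥) , λ u∈ _ u∈f →
      closed-∁ {L = L} cl v∈e (subst (_∈ edge _) (x∈⁅y⁆⇒x≡y v u∈) u∈f) v∉W (x∉p⇒x∈∁p e∉L))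

    -- Each search leaves a closed and exhausted remainder, so the next starts under the same
    -- hypotheses. A component uses up one entry of `vs` and its own hyperedges of `R`.
    components-spec : ∀ vs todo {R} → R ⊆ Edges → Closed W R → Exhausted todo R →
      let Ks = value (components I vs todo R) in
      All (Component W) Ks × sum (map ∣_∣ Ks) ≤ ∣ R ∣ × length Ks ≤ length vs
    components-spec []       todo _ _ _ = [] , z≤n , z≤n
    components-spec (v ∷ vs) todo {R} R⊆E cl ex with v ∈? todo
    ... | no  _ = let cs , total , len = components-spec vs todo R⊆E cl ex in cs , total , m≤n⇒m≤1+n len
    ... | yes v∈ =
      let cs , total , len = components-spec vs _ (λ e∈ → R⊆E (R-sub e∈)) R-closed todo-done
      in K-component ∷ cs , ≤-trans (+-monoʳ-≤ _ total) K+R , s≤s len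
      where
      initial : Search R todo ⁅ v ⁆ ⊥ R
      initial = record
        { K⊆        = λ e∈ → contradiction e∈ ∉⊥
        ; R⊆        = id
        ; split     = inj₂
        ; disjoint  = λ e∈ → contradiction e∈ ∉⊥
        ; K-reached = λ e∈ → contradiction e∈ ∉⊥
        ; exhausted = ex
        }
      grown = grow-spec todo (⊂-wellFounded todo) ⁅ v ⁆ R⊆E cl initial (confined-root v (proj₁ ex v∈))
      open Grown grown

  cost-grow : ∀ I todo a reached K R →
    let t = grow I todo a reached K R ; (_ , R′ , todo′) = value t in
    cost t + (9 * ∣ todo′ ∣ + ∣ R′ ∣) ≤ 2 + (9 * ∣ todo ∣ + ∣ R ∣)
  cost-grow I todo (acc rs) reached K R with nonempty? (reached ∩ todo)
  ... | no  _ = ≤-refl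
  ... | yes (v , v∈) = begin
    5 + (U + (3 + c)) + rest                    ≡⟨ shuffle₁ U c rest ⟩
    8 + U + (c + rest)                          ≤⟨ +-mono-≤ (+-monoʳ-≤ 8 (cost-⋃ N)) ih ⟩
    8 + suc ∣ N ∣ + (2 + (9 * ∣ todo - v ∣ + ∣ R ─ N ∣)) ≡⟨ shuffle₂ (∣ N ∣) (∣ todo - v ∣) (∣ R ─ N ∣) ⟩
    2 + (9 * suc ∣ todo - v ∣ + (∣ N ∣ + ∣ R ─ N ∣)) ≤⟨ +-monoʳ-≤ 2 (+-mono-≤
        (*-monoʳ-≤ 9 (x∈p⇒∣p-x∣<∣p∣ (p∩q⊆q reached todo v∈)))
        (disjoint⇒∣p∣+∣q∣≤∣r∣ (p∩q⊆q (lookup I v) R) (p─q⊆p R N) (λ e∈N e∈ → x∈p─q⇒x∉q {p = R} e∈ e∈N))) ⟩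
    2 + (9 * ∣ todo ∣ + ∣ R ∣) ∎
    where
    open ≤-Reasoning
    N = lookup I v ∩ R
    t′ = grow I (todo - v) (rs (x∈p⇒p-x⊂p (p∩q⊆q reached todo v∈))) (reached ∪ ⋃ᵛ N) (K ∪ N) (R ─ N)
    U = cost (⋃ N)
    c = cost t′
    rest = 9 * ∣ proj₂ (proj₂ (value t′)) ∣ + ∣ proj₁ (proj₂ (value t′)) ∣
    ih = cost-grow I (todo - v) (rs (x∈p⇒p-x⊂p (p∩q⊆q reached todo v∈))) (reached ∪ ⋃ᵛ N) (K ∪ N) (R ─ N)
    shuffle₁ : ∀ U c r → 5 + (U + (3 + c)) + r ≡ 8 + U + (c + r)
    shuffle₁ = solve-∀
    shuffle₂ : ∀ N t r → 8 + suc N + (2 + (9 * t + r)) ≡ 2 + (9 * suc t + (N + r))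
    shuffle₂ = solve-∀

  cost-components : ∀ I vs todo R → cost (components I vs todo R) ≤ 6 * length vs + suc (9 * ∣ todo ∣ + ∣ R ∣)
  cost-components I []       todo R = s≤s z≤n
  cost-components I (v ∷ vs) todo R with v ∈? todo
  ... | no  _ = begin
    1 + cost (components I vs todo R) ≤⟨ +-mono-≤ {1} {6} (s≤s z≤n) (cost-components I vs todo R) ⟩
    6 + (6 * length vs + suc (9 * ∣ todo ∣ + ∣ R ∣)) ≡⟨ shuffle (length vs) _ ⟩
    6 * suc (length vs) + suc (9 * ∣ todo ∣ + ∣ R ∣) ∎
    where
    open ≤-Reasoning
    shuffle : ∀ l x → 6 + (6 * l + x) ≡ 6 * suc l + x
    shuffle = solve-∀
  ... | yes _ = begin
    3 + (cg + (cc + 1)) ≡⟨ shuffle₁ cg cc ⟩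
    4 + cg + cc ≤⟨ +-monoʳ-≤ (4 + cg) (cost-components I vs todo′ R′) ⟩
    4 + cg + (6 * length vs + suc (9 * ∣ todo′ ∣ + ∣ R′ ∣)) ≡⟨ shuffle₂ cg (length vs) _ ⟩
    5 + (6 * length vs + (cg + (9 * ∣ todo′ ∣ + ∣ R′ ∣)))
      ≤⟨ +-monoʳ-≤ 5 (+-monoʳ-≤ (6 * length vs) (cost-grow I todo (⊂-wellFounded todo) ⁅ v ⁆ ⊥ R)) ⟩
    5 + (6 * length vs + (2 + (9 * ∣ todo ∣ + ∣ R ∣))) ≡⟨ shuffle₃ (length vs) _ ⟩
    6 * suc (length vs) + suc (9 * ∣ todo ∣ + ∣ R ∣) ∎
    where
    open ≤-Reasoning
    g = grow I todo (⊂-wellFounded todo) ⁅ v ⁆ ⊥ R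
    cg = cost g
    R′ = proj₁ (proj₂ (value g))
    todo′ = proj₂ (proj₂ (value g))
    cc = cost (components I vs todo′ R′)
    shuffle₁ : ∀ g c → 3 + (g + (c + 1)) ≡ 4 + g + c
    shuffle₁ = solve-∀
    shuffle₂ : ∀ g l x → 4 + g + (6 * l + suc x) ≡ 5 + (6 * l + (g + x))
    shuffle₂ = solve-∀
    shuffle₃ : ∀ l x → 5 + (6 * l + (2 + x)) ≡ 6 * suc l + suc x
    shuffle₃ = solve-∀

  -- As `Edges` is closed outside `⋃ᵛ Separator`, a component found within it is a component of the
  -- whole hypergraph.
  separate-spec : ∀ Edges Separator → Closed (⋃ᵛ Separator) Edges →
    let Ks = value (separate Edges Separator) in
    All (Component (⋃ᵛ Separator)) Ks × sum (map ∣_∣ Ks) ≤ ∣ Edges ∣ × length Ks ≤ m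
  separate-spec Edges Separator cl =
    let cs , total , len = components-spec I I-indexes vs (∁ W) (p─q⊆p Edges Separator) cl′ ex
    in cs , ≤-trans total (∣p─q∣≤∣p∣ Edges Separator) ,
       ≤-trans len (≤-trans (length-elements (value (⋃ Edges) ─ W)) (∣p∣≤n (value (⋃ Edges) ─ W)))
    where
    W = ⋃ᵛ Separator
    I = value (index (elements Edges) W)
    vs = elements (value (⋃ Edges) ─ W)
    I-indexes : Indexes I λ v e → e ∈ Edges × v ∈ edge e × v ∉ W
    I-indexes = let sound , complete = index-indexes (elements Edges) W in
      (λ e∈ → let e∈E , rest = sound e∈ in ∈-elements⁻ e∈E , rest) ,
      λ (e∈E , rest) → complete (∈-elements⁺ e∈E , rest)
    cl′ : Closed W (Edges ─ Separator)
    -- A hyperedge of `Separator` has no vertex outside `W`, so removing `Separator` preserves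
    -- closedness.
    cl′ u∈e u∈f u∉W e∈ = x∈p∧x∉q⇒x∈p─q (cl u∈e u∈f u∉W (p─q⊆p Edges Separator e∈)) λ f∈S → u∉W (∈-⋃⁺ f∈S u∈f)
    ex : Exhausted I I-indexes (∁ W) (Edges ─ Separator)
    ex = x∈∁p⇒x∉p , λ u∉W u∉ _ _ → u∉ (x∉p⇒x∈∁p u∉W)

  cost-separate : ∀ Edges Separator →
    cost (separate Edges Separator) ≤ ∣ Separator ∣ + ∣ Edges ∣ * (m + 4) + 16 * m + 7
  cost-separate Edges Separator = begin
    cW + (cI + (cU + (3 + cC)))
      ≤⟨ +-mono-≤ (cost-⋃ Separator) (+-mono-≤
           (≤-trans (cost-index (elements Edges) W) (+-monoˡ-≤ (suc m) (*-monoˡ-≤ (m + 2) (length-elements Edges))))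
           (+-mono-≤ (cost-⋃ Edges) (+-monoʳ-≤ 3 (≤-trans (cost-components _ (elements V) (∁ W) (Edges ─ Separator))
             (+-mono-≤ (*-monoʳ-≤ 6 (≤-trans (length-elements V) (∣p∣≤n V)))
               (s≤s (+-mono-≤ (*-monoʳ-≤ 9 (∣p∣≤n (∁ W))) (∣p─q∣≤∣p∣ Edges Separator)))))))) ⟩
    suc s + (e * (m + 2) + suc m + (suc e + (3 + (6 * m + suc (9 * m + e))))) ≡⟨ shuffle s e m ⟩
    s + e * (m + 4) + 16 * m + 7 ∎
    where
    open ≤-Reasoning
    s = ∣ Separator ∣
    e = ∣ Edges ∣
    W = ⋃ᵛ Separator
    V = value (⋃ Edges) ─ W
    cW = cost (⋃ Separator)
    cI = cost (index (elements Edges) W)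
    cU = cost (⋃ Edges)
    cC = cost (components (value (index (elements Edges) W)) (elements V) (∁ W) (Edges ─ Separator))
    shuffle : ∀ s e m → suc s + (e * (m + 2) + suc m + (suc e + (3 + (6 * m + suc (9 * m + e)))))
                      ≡ s + e * (m + 4) + 16 * m + 7
    shuffle = solve-∀

-- Boundary edges, and the number and weight of the covers.

module Covering {m n} (H : Hypergraph m n) (k : ℕ) where
  open Hypergraph H
  open Algorithm H k
  open Separation H k

  ∣incident∣≤ : ∀ e → ∣ incident H e ∣ ≤ maxIncident H
  ∣incident∣≤ e = All.lookup (xs≤max 0 (map (∣_∣ ∘ incident H) (allFin n))) (∈-map⁺ (∣_∣ ∘ incident H) (∈-allFin e))

  ∈-incident : ∀ {e f u} → u ∈ edge e → u ∈ edge f → f ∈ incident H e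
  ∈-incident u∈e u∈f = does-true⇒∈tabulate (λ f → nonempty? (edge _ ∩ edge f)) (_ , x∈p∩q⁺ (u∈e , u∈f))

  ∈-boundEdges : ∀ {Conn e} es → e ∈ value (boundEdges Conn es) → Nonempty (edge e ∩ Conn)
  ∈-boundEdges []       e∈ = contradiction e∈ ∉⊥
  ∈-boundEdges {Conn} (f ∷ es) e∈ with nonempty? (edge f ∩ Conn)
  ... | no  _  = ∈-boundEdges es e∈
  ... | yes ne with x∈p∪q⁻ (value (boundEdges Conn es)) ⁅ f ⁆ e∈
  ...   | inj₁ e∈B = ∈-boundEdges es e∈B
  ...   | inj₂ e∈f rewrite x∈⁅y⁆⇒x≡y f e∈f = ne

  cost-boundEdges : ∀ Conn es → cost (boundEdges Conn es) ≤ suc (length es * 3)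
  cost-boundEdges Conn []       = ≤-refl
  cost-boundEdges Conn (e ∷ es) with nonempty? (edge e ∩ Conn)
  ... | no  _ = ≤-trans (+-monoˡ-≤ 2 (cost-boundEdges Conn es)) (≤-trans (≤-reflexive (+-comm _ 2)) (n≤1+n _))
  ... | yes _ = ≤-trans (+-monoˡ-≤ 3 (cost-boundEdges Conn es)) (≤-reflexive (+-comm _ 3))

  M : ℕ
  M = n ⊓ (maxIncident H * k)

  -- A boundary edge meets `Conn`, hence some member of `Separator`, and each of these at most `k`
  -- members has at most `maxIncident H` incident hyperedges.
  ∣boundEdges∣≤ : ∀ {Conn Separator} es → Conn ⊆ ⋃ᵛ Separator → ∣ Separator ∣ ≤ k →
                  ∣ value (boundEdges Conn es) ∣ ≤ M
  ∣boundEdges∣≤ {Conn} {Separator} es Conn⊆ size = ⊓-glb (∣p∣≤n (value (boundEdges Conn es))) (begin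
    ∣ value (boundEdges Conn es) ∣
      ≤⟨ ∣p∣≤length*c (incident H) (elements Separator) hit ∣incident∣≤ ⟩
    length (elements Separator) * maxIncident H
      ≤⟨ *-monoˡ-≤ (maxIncident H) (≤-trans (length-elements Separator) size) ⟩
    k * maxIncident H
      ≡⟨ *-comm k _ ⟩
    maxIncident H * k ∎)
    where
    open ≤-Reasoning
    hit : ∀ {e} → e ∈ value (boundEdges Conn es) → ∃ λ s → s ∈ˡ elements Separator × e ∈ incident H s
    hit e∈ =
      let u , u∈ = ∈-boundEdges es e∈
          u∈e , u∈Conn = x∈p∩q⁻ (edge _) Conn u∈
          s , s∈ , u∈s = ∈-⋃⁻ (Conn⊆ u∈Conn)
      in s , ∈-elements⁺ s∈ , ∈-incident u∈s u∈e

  -- When the minimum is not `n`, choose a hyperedge through each vertex: every hyperedge is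
  -- incident to one of these `m`, and each of them has at most `c` incident ones.
  n≤M*m : 1 ≤ k → 1 ≤ m → n ≤ M * m
  n≤M*m 1≤k 1≤m with ⊓-sel n (maxIncident H * k)
  ... | inj₁ eq rewrite eq = m≤m*n n m ⦃ >-nonZero 1≤m ⦄
  ... | inj₂ eq rewrite eq = begin
    n                           ≡⟨ ∣⊤∣≡n n ⟨
    ∣ ⊤ {n} ∣                   ≤⟨ ∣p∣≤length*c at (allFin m) hit bnd ⟩
    length (allFin m) * c       ≡⟨ cong (_* c) (length-tabulate (id {A = Fin m})) ⟩
    m * c                       ≡⟨ *-comm m c ⟩
    c * m                       ≤⟨ *-monoˡ-≤ m (m≤m*n c k ⦃ >-nonZero 1≤k ⦄) ⟩
    c * k * m                   ∎
    where
    open ≤-Reasoning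
    c = maxIncident H
    at : Fin m → Subset n
    at v = incident H (proj₁ (covered v))
    bnd : ∀ v → ∣ at v ∣ ≤ c
    bnd v = ∣incident∣≤ (proj₁ (covered v))
    hit : ∀ {e} → e ∈ ⊤ → ∃ λ v → v ∈ˡ allFin m × e ∈ at v
    hit {e} _ = let v , v∈e = edge-nonempty e in v , ∈-allFin v , ∈-incident (proj₂ (covered v)) v∈e

  -- A nonempty hyperedge is incident to itself.
  1≤M : 1 ≤ k → 1 ≤ n → 1 ≤ M
  1≤M 1≤k 1≤n = ⊓-glb 1≤n (*-mono-≤ 1≤c 1≤k)
    where
    e : Fin n
    e = fromℕ< 1≤n
    1≤c : 1 ≤ maxIncident H
    1≤c = let v , v∈ = edge-nonempty e in
      ≤-trans (≤-trans (≤-reflexive (sym (∣⁅x⁆∣≡1 e)))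
        (p⊆q⇒∣p∣≤∣q∣ {p = ⁅ e ⁆} λ x∈ → subst (_∈ incident H e) (sym (x∈⁅y⁆⇒x≡y e x∈)) (∈-incident v∈ v∈)))
        (∣incident∣≤ e)

  1≤vertices : 1 ≤ n → 1 ≤ m
  1≤vertices 1≤n = ≤-trans (s≤s z≤n) (Fin.toℕ<n (proj₁ (edge-nonempty (fromℕ< 1≤n))))

  Covers : Subset m → Subset n → Set
  Covers Conn S = ∣ S ∣ ≤ k × Conn ⊆ ⋃ᵛ S

  coverFrom-sound : ∀ j es {Conn S U found} → ∣ S ∣ + j ≤ k → U ⊆ ⋃ᵛ S → All (Covers Conn) found →
                    All (Covers Conn) (value (coverFrom j es Conn S U found))
  coverFrom-sound j es {Conn} {S} {U} size U⊆ all = go j es size U⊆ all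
    where
    emit : ∀ {S U found} → ∣ S ∣ ≤ k → U ⊆ ⋃ᵛ S → All (Covers Conn) found →
           All (Covers Conn) (value (emitIfCover Conn S U found))
    emit {S} {U} size U⊆ all with Conn ⊆? U
    ... | yes Conn⊆U = (size , λ u∈ → U⊆ (Conn⊆U u∈)) ∷ all
    ... | no  _      = all
    go : ∀ j es {S U found} → ∣ S ∣ + j ≤ k → U ⊆ ⋃ᵛ S → All (Covers Conn) found →
         All (Covers Conn) (value (coverFrom j es Conn S U found))
    go zero    es       {S} {U} size U⊆ all = emit {S} {U} (m+n≤o⇒m≤o ∣ S ∣ size) U⊆ all
    go (suc j) []       {S} {U} size U⊆ all = emit {S} {U} (m+n≤o⇒m≤o ∣ S ∣ size) U⊆ all
    go (suc j) (e ∷ es) {S} {U} size U⊆ all =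
      go j es {S ∪ ⁅ e ⁆} {U ∪ edge e} size′ U⊆′ (go (suc j) es {S} {U} size U⊆ all)
      where
      size′ : ∣ S ∪ ⁅ e ⁆ ∣ + j ≤ k
      size′ = ≤-trans (+-monoˡ-≤ j (∣p∪q∣≤∣p∣+∣q∣ S ⁅ e ⁆))
        (≤-trans (≤-reflexive (trans (+-assoc ∣ S ∣ _ j) (cong (λ i → ∣ S ∣ + (i + j)) (∣⁅x⁆∣≡1 e)))) size)
      U⊆′ : U ∪ edge e ⊆ ⋃ᵛ (S ∪ ⁅ e ⁆)
      U⊆′ u∈ with x∈p∪q⁻ U (edge e) u∈
      ... | inj₁ u∈U = let f , f∈ , u∈f = ∈-⋃⁻ (U⊆ u∈U) in ∈-⋃⁺ (p⊆p∪q ⁅ e ⁆ f∈) u∈f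
      ... | inj₂ u∈e = ∈-⋃⁺ (q⊆p∪q S ⁅ e ⁆ (x∈⁅x⁆ e)) u∈e

  cover-sound : ∀ Conn Bound → All (Covers Conn) (value (cover Conn Bound))
  cover-sound Conn Bound = coverFrom-sound k (elements Bound) {S = ⊥}
    (≤-reflexive (cong (_+ k) (∣⊥∣≡0 n))) (λ u∈ → contradiction u∈ ∉⊥) []

  -- Beyond the branch that leaves `e` out, a node costs 2 steps plus the branch that takes `e`, at
  -- most three times the bound for the latter; hence the factor 3.
  cost-coverFrom : ∀ j es Conn S U found → cost (coverFrom j es Conn S U found) ≤ (3 * suc (length es)) ^ j
  cost-coverFrom zero    es       Conn S U found = ≤-refl
  cost-coverFrom (suc j) []       Conn S U found = m^n>0 3 (suc j)
  cost-coverFrom (suc j) (e ∷ es) Conn S U found = begin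
    c₁ + (2 + c₂)            ≤⟨ +-mono-≤ (cost-coverFrom (suc j) es Conn S U found)
                                  (+-monoʳ-≤ 2 (cost-coverFrom j es Conn _ _ _)) ⟩
    3 * b * x + (2 + x)      ≤⟨ +-monoʳ-≤ (3 * b * x) (+-monoˡ-≤ x (*-monoʳ-≤ 2 (m^n>0 (3 * b) j))) ⟩
    3 * b * x + (2 * x + x)  ≡⟨ shuffle b x ⟩
    3 * suc b * x            ≤⟨ *-monoʳ-≤ (3 * suc b) (^-monoˡ-≤ j (*-monoʳ-≤ 3 (n≤1+n b))) ⟩
    (3 * suc b) ^ suc j      ∎
    where
    open ≤-Reasoning
    b = suc (length es)
    x = (3 * b) ^ j
    c₁ = cost (coverFrom (suc j) es Conn S U found)
    c₂ = cost (coverFrom j es Conn (S ∪ ⁅ e ⁆) (U ∪ edge e) (value (coverFrom (suc j) es Conn S U found)))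
    shuffle : ∀ b x → 3 * b * x + (2 * x + x) ≡ 3 * suc b * x
    shuffle = solve-∀

  -- An upper bound on the number of choices for AddSep, when |Edges| = r.
  weight : ℕ → Subset n → ℕ
  weight r S with ∣ S ∣ <? k
  ... | yes _ = r
  ... | no  _ = 1

  -- With j hyperedges still to be chosen, there are about b^j covers of full size,
  -- of weight 1, but only about b^(j-1) smaller ones, of weight r.
  totalWeight : ℕ → ℕ → ℕ → ℕ
  totalWeight r zero    b = 1
  totalWeight r (suc j) b = b ^ j * (b + r)

  totalWeight-step : ∀ r j b → totalWeight r (suc j) b + totalWeight r j b ≤ totalWeight r (suc j) (suc b)
  totalWeight-step r zero    b = ≤-reflexive
    (trans (cong (_+ 1) (+-identityʳ (b + r))) (trans (+-comm (b + r) 1) (sym (+-identityʳ _))))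
  totalWeight-step r (suc j) b = begin
    b * b ^ j * (b + r) + b ^ j * (b + r)  ≡⟨ shuffle b (b ^ j) r ⟩
    suc b * b ^ j * (b + r)                ≤⟨ *-mono-≤ (*-monoʳ-≤ (suc b) (^-monoˡ-≤ j (n≤1+n b))) (n≤1+n (b + r)) ⟩
    suc b * suc b ^ j * (suc b + r)        ∎
    where
    open ≤-Reasoning
    shuffle : ∀ b x r → b * x * (b + r) + x * (b + r) ≡ suc b * x * (b + r)
    shuffle = solve-∀

  module _ (r : ℕ) (1≤r : 1 ≤ r) where

    weight≤r : ∀ S → weight r S ≤ r
    weight≤r S with ∣ S ∣ <? k
    ... | yes _ = ≤-refl
    ... | no  _ = 1≤r

    weight-full : ∀ S → k ≤ ∣ S ∣ → weight r S ≡ 1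
    weight-full S k≤ with ∣ S ∣ <? k
    ... | yes <k = contradiction k≤ (<⇒≱ <k)
    ... | no  _  = refl

    emit-weight : ∀ {Conn S U} found {w} → weight r S ≤ w →
      sum (map (weight r) (value (emitIfCover Conn S U found))) ≤ sum (map (weight r) found) + w
    emit-weight {Conn} {S} {U} found w≥ with Conn ⊆? U
    ... | yes _ = ≤-trans (≤-reflexive (+-comm (weight r S) _)) (+-monoʳ-≤ _ w≥)
    ... | no  _ = m≤m+n _ _

    -- Each choice adds a new hyperedge, so `k ≤ ∣ S ∣ + j` persists and a set emitted at `j = 0` is
    -- full, of weight 1. Only where the list runs out early can a smaller set, of weight `r`, be
    -- emitted.
    coverFrom-weight : ∀ j {es} Conn S U found → Unique es → All (_∉ S) es → k ≤ ∣ S ∣ + j →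
      sum (map (weight r) (value (coverFrom j es Conn S U found)))
        ≤ sum (map (weight r) found) + totalWeight r j (suc (length es))
    coverFrom-weight zero Conn S U found _ _ k≤ =
      emit-weight {Conn} {S} {U} found (≤-reflexive (weight-full S (≤-trans k≤ (≤-reflexive (+-identityʳ _)))))
    coverFrom-weight (suc j) Conn S U found [] _ k≤ =
      emit-weight {Conn} {S} {U} found (≤-trans (weight≤r S) (≤-trans (n≤1+n r)
        (m≤n*m (suc r) (1 ^ j) ⦃ >-nonZero (m^n>0 1 j) ⦄)))
    coverFrom-weight (suc j) {e ∷ es} Conn S U found (e# ∷ u) (e∉ ∷ es∉) k≤ = begin
      sum (map w (value (coverFrom j es Conn (S ∪ ⁅ e ⁆) (U ∪ edge e) found′)))
        ≤⟨ coverFrom-weight j Conn (S ∪ ⁅ e ⁆) (U ∪ edge e) found′ u (All.zipWith avoid (e# , es∉)) k≤′ ⟩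
      sum (map w found′) + totalWeight r j b
        ≤⟨ +-monoˡ-≤ _ (coverFrom-weight (suc j) Conn S U found u es∉ k≤) ⟩
      sum (map w found) + totalWeight r (suc j) b + totalWeight r j b
        ≡⟨ +-assoc (sum (map w found)) _ _ ⟩
      sum (map w found) + (totalWeight r (suc j) b + totalWeight r j b)
        ≤⟨ +-monoʳ-≤ (sum (map w found)) (totalWeight-step r j b) ⟩
      sum (map w found) + totalWeight r (suc j) (suc b) ∎
      where
      open ≤-Reasoning
      w = weight r
      b = suc (length es)
      found′ = value (coverFrom (suc j) es Conn S U found)
      avoid : ∀ {x} → e ≢ x × x ∉ S → x ∉ S ∪ ⁅ e ⁆
      avoid (e≢x , x∉S) x∈ = [ x∉S , (λ x∈e → e≢x (sym (x∈⁅y⁆⇒x≡y e x∈e))) ]′ (x∈p∪q⁻ S ⁅ e ⁆ x∈)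
      k≤′ : k ≤ ∣ S ∪ ⁅ e ⁆ ∣ + j
      k≤′ = ≤-trans k≤ (≤-trans (≤-reflexive (+-suc ∣ S ∣ j)) (+-monoˡ-≤ j (≤-trans
        (≤-reflexive (trans (+-comm 1 ∣ S ∣) (cong (∣ S ∣ +_) (sym (∣⁅x⁆∣≡1 e)))))
        (disjoint⇒∣p∣+∣q∣≤∣r∣ (p⊆p∪q {p = S} ⁅ e ⁆) (q⊆p∪q S ⁅ e ⁆)
          λ x∈S x∈e → e∉ (subst (_∈ S) (x∈⁅y⁆⇒x≡y e x∈e) x∈S)))))

    cover-weight : ∀ Conn Bound →
      sum (map (weight r) (value (cover Conn Bound))) ≤ totalWeight r k (suc (length (elements Bound)))
    cover-weight Conn Bound = coverFrom-weight k Conn ⊥ ⊥ [] (elements-unique Bound) (All.tabulate λ _ → ∉⊥)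
      (m≤n+m k ∣ ⊥ {n} ∣)

-- The potential, and how recorded components pay for recursive calls.

module Amortisation {m n} (H : Hypergraph m n) (k : ℕ) where
  open Hypergraph H
  open Algorithm H k
  open Separation H k
  open Covering H k

  Pairs : Set
  Pairs = List (Subset n × Subset n)

  used : Pairs → Subset n → Subset n
  used []             S = ⊥
  used ((S′ , K) ∷ ps) S with S ≟ˢ S′
  ... | yes _ = K ∪ used ps S
  ... | no  _ = used ps S

  ∈-used⁻ : ∀ ps {S e} → e ∈ used ps S → ∃ λ K → (S , K) ∈ˡ ps × e ∈ K
  ∈-used⁻ []              e∈ = contradiction e∈ ∉⊥
  ∈-used⁻ ((S′ , K) ∷ ps) {S} e∈ with S ≟ˢ S′
  ... | no  _ = let K′ , p , e∈K = ∈-used⁻ ps e∈ in K′ , there p , e∈K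
  ... | yes refl with x∈p∪q⁻ K (used ps S) e∈
  ...   | inj₁ e∈K = K , here refl , e∈K
  ...   | inj₂ e∈U = let K′ , p , e∈K = ∈-used⁻ ps e∈U in K′ , there p , e∈K

  ∈-used⁺ : ∀ {ps S K e} → (S , K) ∈ˡ ps → e ∈ K → e ∈ used ps S
  ∈-used⁺ {(S′ , K) ∷ ps} {S} p e∈ with S ≟ˢ S′ | p
  ... | yes _   | here refl = p⊆p∪q _ e∈
  ... | yes _   | there p   = q⊆p∪q K _ (∈-used⁺ p e∈)
  ... | no S≢S′ | here refl = contradiction refl S≢S′
  ... | no _    | there p   = ∈-used⁺ p e∈

  Visited : Globals n → Subset n × Subset n → Set
  Visited g p = p ∈ˡ failSeps g ⊎ p ∈ˡ succSeps g

  free : Globals n → Subset n → Subset n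
  free g S = ∁ (used (failSeps g) S ∪ used (succSeps g) S)

  ∈-free⁺ : ∀ g {S e} → (∀ {K} → Visited g (S , K) → e ∉ K) → e ∈ free g S
  ∈-free⁺ g {S} h = x∉p⇒x∈∁p λ e∈ →
    [ (λ x → let _ , p , e∈K = ∈-used⁻ (failSeps g) x in h (inj₁ p) e∈K)
    , (λ x → let _ , p , e∈K = ∈-used⁻ (succSeps g) x in h (inj₂ p) e∈K) ]′
    (x∈p∪q⁻ (used (failSeps g) S) (used (succSeps g) S) e∈)

  ∈-free⁻ : ∀ g {S e K} → e ∈ free g S → Visited g (S , K) → e ∉ K
  ∈-free⁻ g {S} e∈ (inj₁ p) e∈K = x∈∁p⇒x∉p e∈ (p⊆p∪q _ (∈-used⁺ p e∈K))
  ∈-free⁻ g {S} e∈ (inj₂ p) e∈K = x∈∁p⇒x∉p e∈ (q⊆p∪q (used (failSeps g) S) _ (∈-used⁺ p e∈K))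

  -- The number of pairs (S , e) for which no component recorded with S contains e.
  Φ : Globals n → ℕ
  Φ g = sum (map (∣_∣ ∘ free g) (smallSubsets n k))

  Φ≤ : ∀ g → Φ g ≤ suc n ^ k * n
  Φ≤ g = ≤-trans (sum-map≤length* (smallSubsets n k) λ S → ∣p∣≤n (free g S)) (*-monoˡ-≤ n (length-smallSubsets n k))

  -- `K` misses everything recorded with `S`, so it lies in the old free set and outside the new
  -- one; `∣ S ∣ ≤ k` puts `S` among the summands of `Φ`.
  Φ-drop : ∀ {g g′ S K} → ∣ S ∣ ≤ k → (∀ {p} → Visited g p → Visited g′ p) → Visited g′ (S , K) →
           (∀ {e K′} → Visited g (S , K′) → e ∈ K → e ∉ K′) → Φ g′ + ∣ K ∣ ≤ Φ g
  Φ-drop {g} {g′} {S} {K} size mono new fresh = sum-map-drop (∈-smallSubsets S size)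
    (λ S′ → p⊆q⇒∣p∣≤∣q∣ (smaller S′))
    (disjoint⇒∣p∣+∣q∣≤∣r∣ (smaller S) (λ e∈K → ∈-free⁺ g λ vis → fresh vis e∈K) (λ e∈ → ∈-free⁻ g′ e∈ new))
    where
    smaller : ∀ S′ → free g′ S′ ⊆ free g S′
    smaller S′ e∈ = ∈-free⁺ g λ vis → ∈-free⁻ g′ e∈ (mono vis)

  -- By `component-unique`, this makes the sets recorded with one separator pairwise equal or
  -- disjoint.
  Consistent : Globals n → Set
  Consistent g = ∀ {S K} → Visited g (S , K) → Component (⋃ᵛ S) K

  -- What decompCov costs beyond B steps per hyperedge.
  K₀ : ℕ
  K₀ = k + 4

  -- What decompSub spends on a component, apart from running through it.
  Q : ℕ
  Q = k + K₀ + 6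

  module Potential (B : ℕ) where

    -- A run inside a call for the hyperedges E, of amortised cost X.  As every newly
    -- recorded component is strictly below E, the call cannot record E itself.
    record Run (E : Subset n) (X : ℕ) (g : Globals n) (c : ℕ) (g′ : Globals n) : Set where
      field
        consistent : Consistent g′
        new-fail   : ∀ {p} → p ∈ˡ failSeps g′ → p ∈ˡ failSeps g ⊎ proj₂ p ⊂ E
        new-succ   : ∀ {p} → p ∈ˡ succSeps g′ → p ∈ˡ succSeps g ⊎ proj₂ p ⊂ E
        amortised  : c + B * Φ g′ ≤ B * Φ g + X
    open Run public

    module _ {E : Subset n} where

      idle : ∀ {g c X} → Consistent g → c ≤ X → Run E X g c g
      idle {g} con c≤ = record
        { consistent = con ; new-fail = inj₁ ; new-succ = inj₁
        ; amortised = ≤-trans (≤-reflexive (+-comm _ (B * Φ g))) (+-monoʳ-≤ (B * Φ g) c≤) }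

      infixr 5 _⨾_
      _⨾_ : ∀ {X Y g g₁ g₂ c d} → Run E X g c g₁ → Run E Y g₁ d g₂ → Run E (X + Y) g (c + d) g₂
      _⨾_ {X} {Y} {g} {g₁} {g₂} {c} {d} r s = record
        { consistent = consistent s
        ; new-fail = λ p → [ new-fail r , inj₂ ]′ (new-fail s p)
        ; new-succ = λ p → [ new-succ r , inj₂ ]′ (new-succ s p)
        ; amortised = begin
            c + d + B * Φ g₂    ≡⟨ +-assoc c d _ ⟩
            c + (d + B * Φ g₂)  ≤⟨ +-monoʳ-≤ c (amortised s) ⟩
            c + (B * Φ g₁ + Y)  ≡⟨ +-assoc c _ Y ⟨
            c + B * Φ g₁ + Y    ≤⟨ +-monoˡ-≤ Y (amortised r) ⟩
            B * Φ g + X + Y     ≡⟨ +-assoc _ X Y ⟩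
            B * Φ g + (X + Y)   ∎ }
        where open ≤-Reasoning

      delay : ∀ {X Y g g′ c d} → c ≤ X → Run E Y g d g′ → Run E (X + Y) g (c + d) g′
      delay {X} {Y} {g} {g′} {c} {d} c≤ r = record
        { consistent = consistent r ; new-fail = new-fail r ; new-succ = new-succ r
        ; amortised = begin
            c + d + B * Φ g′    ≡⟨ +-assoc c d _ ⟩
            c + (d + B * Φ g′)  ≤⟨ +-mono-≤ c≤ (amortised r) ⟩
            X + (B * Φ g + Y)   ≡⟨ swap X (B * Φ g) Y ⟩
            B * Φ g + (X + Y)   ∎ }
        where
        open ≤-Reasoning
        swap : ∀ x b y → x + (b + y) ≡ b + (x + y)
        swap = solve-∀

      relax : ∀ {X Y g g′ c} → X ≤ Y → Run E X g c g′ → Run E Y g c g′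
      relax X≤Y r = record
        { consistent = consistent r ; new-fail = new-fail r ; new-succ = new-succ r
        ; amortised = ≤-trans (amortised r) (+-monoʳ-≤ _ X≤Y) }

      -- Components recorded with S are equal or disjoint, so the hyperedges of K all
      -- leave Φ; this pays for the B * ∣ K ∣ steps of the call.
      record-component : ∀ {K S X g c g₁ g₂} → K ⊂ E → ∣ S ∣ ≤ k → Component (⋃ᵛ S) K →
        Run K (B * ∣ K ∣ + X) g c g₁ →
        (∀ {e} → e ∈ K → ¬ Visited g (S , K)) →
        (∀ {p} → p ∈ˡ failSeps g₂ → p ∈ˡ failSeps g₁ ⊎ p ≡ (S , K)) →
        (∀ {p} → p ∈ˡ succSeps g₂ → p ∈ˡ succSeps g₁ ⊎ p ≡ (S , K)) →
        (∀ {p} → Visited g₁ p → Visited g₂ p) → Visited g₂ (S , K) →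
        Run E (X + 1) g (c + 1) g₂
      record-component {K} {S} {X} {g} {c} {g₁} {g₂} K⊂E size comp r unvisited fails succs mono new = record
        { consistent = con
        ; new-fail = λ p → step-new (new-fail r) (fails p)
        ; new-succ = λ p → step-new (new-succ r) (succs p)
        -- `B * ∣ K ∣` is added to both sides: on the left it joins `Φ g₂` to be absorbed by the
        -- drop, on the right it is the charge of `r`.
        ; amortised = +-cancelʳ-≤ (B * ∣ K ∣) _ _ (begin
            c + 1 + B * Φ g₂ + B * ∣ K ∣   ≡⟨ shuffle₁ c (Φ g₂) (∣ K ∣) B ⟩
            c + B * (Φ g₂ + ∣ K ∣) + 1     ≤⟨ +-monoˡ-≤ 1 (+-monoʳ-≤ c (*-monoʳ-≤ B drop)) ⟩
            c + B * Φ g₁ + 1               ≤⟨ +-monoˡ-≤ 1 (amortised r) ⟩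
            B * Φ g + (B * ∣ K ∣ + X) + 1  ≡⟨ shuffle₂ (B * Φ g) (B * ∣ K ∣) X ⟩
            B * Φ g + (X + 1) + B * ∣ K ∣  ∎) }
        where
        open ≤-Reasoning
        shuffle₁ : ∀ c f s b → c + 1 + b * f + b * s ≡ c + b * (f + s) + 1
        shuffle₁ = solve-∀
        shuffle₂ : ∀ f s x → f + (s + x) + 1 ≡ f + (x + 1) + s
        shuffle₂ = solve-∀
        step-new : ∀ {p} {P Q : Set} → (P → Q ⊎ proj₂ p ⊂ K) → P ⊎ p ≡ (S , K) → Q ⊎ proj₂ p ⊂ E
        step-new old (inj₁ p) with old p
        ... | inj₁ q   = inj₁ q
        ... | inj₂ p⊂K = inj₂ (⊂-trans p⊂K K⊂E)
        step-new old (inj₂ refl) = inj₂ K⊂E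
        con : Consistent g₂
        con (inj₁ p) with fails p
        ... | inj₁ q    = consistent r (inj₁ q)
        ... | inj₂ refl = comp
        con (inj₂ p) with succs p
        ... | inj₁ q    = consistent r (inj₂ q)
        ... | inj₂ refl = comp
        still-unvisited : ∀ {e} → e ∈ K → ¬ Visited g₁ (S , K)
        still-unvisited e∈ (inj₁ p) = [ (λ q → unvisited e∈ (inj₁ q)) , ⊂-irref refl ]′ (new-fail r p)
        still-unvisited e∈ (inj₂ p) = [ (λ q → unvisited e∈ (inj₂ q)) , ⊂-irref refl ]′ (new-succ r p)
        fresh : ∀ {e K′} → Visited g₁ (S , K′) → e ∈ K → e ∉ K′
        fresh vis e∈K e∈K′ with component-unique comp (consistent r vis) e∈K e∈K′
        ... | refl = still-unvisited e∈K vis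
        drop : Φ g₂ + ∣ K ∣ ≤ Φ g₁
        drop = Φ-drop {g₁} {g₂} size mono new fresh

    Result : ∀ {A : Set} → Subset n → ℕ → Globals n → Timed (A × Globals n) → Set
    Result E X g t = Run E X g (cost t) (proj₂ (value t))

    -- `Conn` is where `Edges` may touch the rest of the hypergraph, so closedness is claimed
    -- outside it. The boundary bound is carried along because it comes from the parent's separator,
    -- which the call does not see.
    Ready : Subset n → Subset m → Globals n → Set
    Ready Edges Conn g = Closed Conn Edges × ∣ value (boundEdges Conn (elements ⊤)) ∣ ≤ M × Consistent g

    RecSpec : ∀ {Edges} → Rec Edges → Set
    RecSpec {Edges} rec = ∀ {Comp} (lt : Comp ⊂ Edges) Conn g → Ready Comp Conn g →
      Result Comp (B * ∣ Comp ∣ + K₀) g (rec lt Conn g)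

    -- The witness `e` restricts the claim to nonempty `K`, for which `still-unfailed` can rule out
    -- later recordings.
    Unfailed : Subset n → Globals n → Subset n → Set
    Unfailed S g K = ∀ e → e ∈ K → (S , K) ∉ˡ failSeps g

    subCost : List (Subset n) → ℕ
    subCost Ks = sum (map (λ K → ∣ K ∣ + Q) Ks) + 1

    subCost≤ : ∀ Ks → subCost Ks ≤ sum (map ∣_∣ Ks) + length Ks * Q + 1
    subCost≤ Ks = +-monoˡ-≤ 1 (go Ks)
      where
      shuffle : ∀ a q s l → a + q + (s + l) ≡ a + s + (q + l)
      shuffle = solve-∀
      go : ∀ Ks → sum (map (λ K → ∣ K ∣ + Q) Ks) ≤ sum (map ∣_∣ Ks) + length Ks * Q
      go []       = z≤n
      go (K ∷ Ks) = ≤-trans (+-monoʳ-≤ (∣ K ∣ + Q) (go Ks)) (≤-reflexive (shuffle (∣ K ∣) Q _ _))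

    -- A vertex of a hyperedge of `K` lies in `⋃ᵛ K`, so outside `ChildConn` it is outside `⋃ᵛ S`,
    -- where `K` is closed.
    child-ready : ∀ {S K g} → ∣ S ∣ ≤ k → Component (⋃ᵛ S) K → Consistent g → Ready K (⋃ᵛ K ∩ ⋃ᵛ S) g
    child-ready {S} {K} size (cl , _) con =
      (λ u∈e u∈f u∉ e∈K → cl u∈e u∈f (λ u∈S → u∉ (x∈p∩q⁺ (∈-⋃⁺ e∈K u∈e , u∈S))) e∈K) ,
      ∣boundEdges∣≤ (elements ⊤) (p∩q⊆q (⋃ᵛ K) (⋃ᵛ S)) size , con

    cost-⋃S≤ : ∀ {S} → ∣ S ∣ ≤ k → cost (⋃ S) ≤ suc k
    cost-⋃S≤ {S} size = ≤-trans (cost-⋃ S) (s≤s size)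

    -- The call for `K` newly records only proper subsets of `K`. A nonempty component among them
    -- would share a hyperedge with `K` and so equal `K`.
    still-unfailed : ∀ {S K K′ X g c g₁} → Run K X g c g₁ → Component (⋃ᵛ S) K → Component (⋃ᵛ S) K′ →
      Unfailed S g K′ → Unfailed S g₁ K′
    still-unfailed r comp comp′ unf e e∈ p with new-fail r p
    ... | inj₁ q    = unf e e∈ q
    ... | inj₂ K′⊂K = ⊂-irref (component-unique comp′ comp e∈ (p⊂q⇒p⊆q K′⊂K e∈)) K′⊂K

    recast : ∀ {E X g c d g′} → c ≡ d → Run E X g c g′ → Run E X g d g′
    recast refl r = r

    module _ {E S K X g c g₁} (K⊂E : K ⊂ E) (size : ∣ S ∣ ≤ k) (comp : Component (⋃ᵛ S) K)
             (r : Run K (B * ∣ K ∣ + X) g c g₁) (unf : Unfailed S g K) (∉succ : (S , K) ∉ˡ succSeps g) where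

      unvisited : ∀ {e} → e ∈ K → ¬ Visited g (S , K)
      unvisited e∈ = [ unf _ e∈ , ∉succ ]′

      record-fail : Run E (X + 1) g (c + 1) (globals ((S , K) ∷ failSeps g₁) (succSeps g₁))
      record-fail = record-component K⊂E size comp r unvisited
        (λ { (here eq) → inj₂ eq ; (there p) → inj₁ p }) inj₁
        [ (λ p → inj₁ (there p)) , inj₂ ]′ (inj₁ (here refl))

      record-succ : Run E (X + 1) g (c + 1) (globals (failSeps g₁) ((S , K) ∷ succSeps g₁))
      record-succ = record-component K⊂E size comp r unvisited
        inj₁ (λ { (here eq) → inj₂ eq ; (there p) → inj₁ p })
        [ inj₁ , (λ p → inj₂ (there p)) ]′ (inj₂ (here refl))

    private
      pruned-fits : ∀ s K₀ x → suc s + (suc k + (3 + (x + 1 + 1))) ≤ s + (k + K₀ + 6) + x + 1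
      pruned-fits s K₀ x = ≤-trans (m≤m+n _ K₀) (≤-reflexive (eq s k K₀ x))
        where
        eq : ∀ s k K₀ x → suc s + (suc k + (3 + (x + 1 + 1))) + K₀ ≡ s + (k + K₀ + 6) + x + 1
        eq = solve-∀

      failure-fits : ∀ s K₀ x → suc s + (suc k + (2 + (K₀ + 1))) ≤ s + (k + K₀ + 6) + x + 1
      failure-fits s K₀ x = ≤-trans (m≤m+n _ (2 + x)) (≤-reflexive (eq s k K₀ x))
        where
        eq : ∀ s k K₀ x → suc s + (suc k + (2 + (K₀ + 1))) + (2 + x) ≡ s + (k + K₀ + 6) + x + 1
        eq = solve-∀

      -- The dearest of the three outcomes; it fits exactly and so determines the 6 in `Q`.
      success-fits : ∀ s k K₀ x → suc s + (suc k + (2 + (K₀ + 1 + (x + 1 + 1)))) ≡ s + (k + K₀ + 6) + x + 1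
      success-fits = solve-∀

    -- Here and below, abstract keeps proof terms from being normalised when
    -- they occur in a with-expression.
    abstract
      decompSub-spec : ∀ {Edges Ks} (rec : Rec Edges) → RecSpec rec → (smaller : All (_⊂ Edges) Ks) → ∀ S g →
        ∣ S ∣ ≤ k → All (Component (⋃ᵛ S)) Ks → All (Unfailed S g) Ks → Consistent g →
        Result Edges (subCost Ks) g (decompSub rec smaller S g)
      decompSub-spec rec spec [] S g size [] [] con = idle con ≤-refl
      decompSub-spec {Edges} {K ∷ Ks} rec spec (lt ∷ lts) S g size (comp ∷ comps) (unf ∷ unfs) con
        with (S , K) ∈ᵖ? succSeps g
      ... | yes _ with decompSub rec lts S g | decompSub-spec rec spec lts S g size comps unfs con
      ...   | c ▹ (nothing , g₁) | r = relax (pruned-fits (∣ K ∣) K₀ _)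
        (delay (cost-⋃ K) (delay (cost-⋃S≤ size) (delay {X = 3} ≤-refl (r ⨾ idle {X = 1} (consistent r) z≤n))))
      ...   | c ▹ (just _ , g₁) | r = relax (pruned-fits (∣ K ∣) K₀ _)
        (delay (cost-⋃ K) (delay (cost-⋃S≤ size) (delay {X = 3} ≤-refl (r ⨾ idle {X = 1} (consistent r) ≤-refl))))
      -- The pair is in neither list, so whichever outcome is recorded refunds the `B * ∣ K ∣`
      -- charged by the recursive call.
      decompSub-spec {Edges} {K ∷ Ks} rec spec (lt ∷ lts) S g size (comp ∷ comps) (unf ∷ unfs) con
        | no ∉succ with rec lt (⋃ᵛ K ∩ ⋃ᵛ S) g | spec lt (⋃ᵛ K ∩ ⋃ᵛ S) g (child-ready size comp con)
      ...   | c ▹ (nothing , g₁) | r = relax (failure-fits (∣ K ∣) K₀ _)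
        (delay (cost-⋃ K) (delay (cost-⋃S≤ size) (delay {X = 2} ≤-refl (record-fail lt size comp r unf ∉succ))))
      ...   | c ▹ (just _ , g₁) | r
        with decompSub rec lts S (globals (failSeps g₁) ((S , K) ∷ succSeps g₁))
           | decompSub-spec rec spec lts S (globals (failSeps g₁) ((S , K) ∷ succSeps g₁)) size comps
               (All.zipWith (λ (comp′ , unf′) → still-unfailed r comp comp′ unf′) (comps , unfs))
               (consistent (record-succ lt size comp r unf ∉succ))
      ...     | d ▹ (nothing , g₂) | r′ = relax (≤-reflexive (success-fits (∣ K ∣) k K₀ _))
        (delay (cost-⋃ K) (delay (cost-⋃S≤ size) (delay {X = 2} ≤-refl (recast (+-assoc c 1 _)
          (record-succ lt size comp r unf ∉succ ⨾ r′ ⨾ idle {X = 1} (consistent r′) z≤n)))))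
      ...     | d ▹ (just _ , g₂) | r′ = relax (≤-reflexive (success-fits (∣ K ∣) k K₀ _))
        (delay (cost-⋃ K) (delay (cost-⋃S≤ size) (delay {X = 2} ≤-refl (recast (+-assoc c 1 _)
          (record-succ lt size comp r unf ∉succ ⨾ r′ ⨾ idle {X = 1} (consistent r′) ≤-refl)))))

-- Amortised cost of the mutually dependent search procedures.

module RunningTime {m n} (H : Hypergraph m n) (k : ℕ) (B : ℕ) where
  open Hypergraph H
  open Algorithm H k
  open Separation H k
  open Covering H k
  open Amortisation H k
  open Potential B

  abstract
    noneFailed-spec : ∀ S Ks g → let t = noneFailed S Ks g in
      cost t ≤ suc (length Ks) × proj₂ (value t) ≡ g × (proj₁ (value t) ≡ true → All (Unfailed S g) Ks)
    noneFailed-spec S []       g = ≤-refl , refl , λ _ → []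
    noneFailed-spec S (K ∷ Ks) g with (S , K) ∈ᵖ? failSeps g
    ... | yes _ = s≤s z≤n , refl , λ ()
    ... | no ∉fail = let c≤ , same , unf = noneFailed-spec S Ks g in
      s≤s c≤ , same , λ none → (λ _ _ → ∉fail) ∷ unf none

  sepCost : ℕ → ℕ
  sepCost r = k + r * (m + 4) + 16 * m + 7

  -- Bundled so that a single `with` can abstract the cost and result of `separate` together with
  -- the facts about them.
  record Separated (Edges S : Subset n) (c : ℕ) (Ks : List (Subset n)) : Set where
    constructor separated
    field
      c-sep : c ≤ sepCost ∣ Edges ∣
      comps : All (Component (⋃ᵛ S)) Ks
      total : sum (map ∣_∣ Ks) ≤ ∣ Edges ∣
      len   : length Ks ≤ m

  abstract
    separated-spec : ∀ Edges S → Closed (⋃ᵛ S) Edges → ∣ S ∣ ≤ k →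
      Separated Edges S (cost (separate Edges S)) (value (separate Edges S))
    separated-spec Edges S cl size =
      let comps , total , len = separate-spec Edges S cl in
      separated (≤-trans (cost-separate Edges S)
        (+-monoˡ-≤ 7 (+-monoˡ-≤ (16 * m) (+-monoˡ-≤ (∣ Edges ∣ * (m + 4)) size)))) comps total len

  subCost-bound : ∀ Ks {e} → sum (map ∣_∣ Ks) ≤ e → length Ks ≤ m → subCost Ks ≤ e + m * Q + 1
  subCost-bound Ks total len = ≤-trans (subCost≤ Ks) (+-monoˡ-≤ 1 (+-mono-≤ total (*-monoˡ-≤ Q len)))

  -- The cost of one choice for AddSep, apart from recursive calls, when |Edges| = r.
  tryCost : ℕ → ℕ
  tryCost r = 1 + (sepCost r + (suc m + ((r + m * Q + 1) + (k + 4))))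

  tryAddSeps-spec : ∀ {Edges} (rec : Rec Edges) → RecSpec rec → ∀ {Conn CovSep InCovSep} seps g →
    Closed Conn Edges → Conn ⊆ ⋃ᵛ CovSep → InCovSep ⊆ CovSep → All (λ (AddSep , _) → ∣ CovSep ∪ AddSep ∣ ≤ k) seps →
    Consistent g → Result Edges (length seps * tryCost ∣ Edges ∣ + 1) g (tryAddSeps rec Conn CovSep InCovSep seps g)
  tryAddSeps-spec rec spec [] g cl Conn⊆ In⊆ [] con = idle con ≤-refl
  tryAddSeps-spec {Edges} rec spec {Conn} {CovSep} {InCovSep} ((AddSep , ne) ∷ seps) g cl Conn⊆ In⊆ (size ∷ sizes) con
    with cost (separate Edges (CovSep ∪ AddSep))
       | value (separate Edges (CovSep ∪ AddSep))
       | separate-⊂ Edges (CovSep ∪ AddSep) ne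
       | separated-spec Edges (CovSep ∪ AddSep) Conn-free size
    where
    -- `Edges` is closed outside `Conn`, and `Conn` is covered by `CovSep`, so `Edges` is closed
    -- outside the larger set as well.
    Conn-free : Closed (⋃ᵛ (CovSep ∪ AddSep)) Edges
    Conn-free u∈e u∈f u∉ = cl u∈e u∈f λ u∈Conn →
      let _ , e∈ , u∈e′ = ∈-⋃⁻ (Conn⊆ u∈Conn) in u∉ (∈-⋃⁺ (p⊆p∪q AddSep e∈) u∈e′)
  ... | cs | Ks | smaller | separated c-sep comps total len
    with noneFailed (CovSep ∪ AddSep) Ks g | noneFailed-spec (CovSep ∪ AddSep) Ks g
  ...   | c ▹ (false , g₁) | c≤ , refl , _ =
    relax (fits (sepCost (∣ Edges ∣)) m (∣ Edges ∣ + m * Q + 1 + (k + 4)) (length seps * tryCost (∣ Edges ∣)))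
      (delay {X = 1} ≤-refl (delay c-sep (delay (≤-trans c≤ (s≤s len))
        (tryAddSeps-spec rec spec seps g cl Conn⊆ In⊆ sizes con))))
    where
    fits : ∀ σ m x r → 1 + (σ + (suc m + (r + 1))) ≤ 1 + (σ + (suc m + x)) + r + 1
    fits σ m x r = ≤-trans (m≤m+n _ x) (≤-reflexive (eq σ m x r))
      where
      eq : ∀ σ m x r → 1 + (σ + (suc m + (r + 1))) + x ≡ 1 + (σ + (suc m + x)) + r + 1
      eq = solve-∀
  ...   | c ▹ (true , g₁) | c≤ , refl , unf
    with decompSub rec smaller (CovSep ∪ AddSep) g
       | decompSub-spec rec spec smaller (CovSep ∪ AddSep) g size comps (unf refl) con
  ...     | d ▹ (nothing , g₂) | r =
    relax (fits (sepCost (∣ Edges ∣)) m (∣ Edges ∣ + m * Q + 1) (k + 4) (length seps * tryCost (∣ Edges ∣)))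
      (delay {X = 1} ≤-refl (delay c-sep (delay (≤-trans c≤ (s≤s len))
        (relax (subCost-bound Ks total len) r ⨾ tryAddSeps-spec rec spec seps g₂ cl Conn⊆ In⊆ sizes (consistent r)))))
    where
    fits : ∀ σ m x y r → 1 + (σ + (suc m + (x + (r + 1)))) ≤ 1 + (σ + (suc m + (x + y))) + r + 1
    fits σ m x y r = ≤-trans (m≤m+n _ y) (≤-reflexive (eq σ m x y r))
      where
      eq : ∀ σ m x y r → 1 + (σ + (suc m + (x + (r + 1)))) + y ≡ 1 + (σ + (suc m + (x + y))) + r + 1
      eq = solve-∀
  ...     | d ▹ (just _ , g₂) | r =
    relax (≤-trans (m≤m+n _ (length seps * tryCost (∣ Edges ∣))) (m≤m+n _ 1))
      (delay {X = 1} ≤-refl (delay c-sep (delay (≤-trans c≤ (s≤s len))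
        (relax (subCost-bound Ks total len) r ⨾ idle (consistent r) tail))))
    where
    tail : 1 + (cost (⋃ (InCovSep ∪ AddSep)) + 2) ≤ k + 4
    tail = ≤-trans (+-monoʳ-≤ 1 (+-monoˡ-≤ 2 (≤-trans (cost-⋃ (InCovSep ∪ AddSep)) (s≤s (≤-trans
      (p⊆q⇒∣p∣≤∣q∣ {p = InCovSep ∪ AddSep} {CovSep ∪ AddSep} λ e∈ → x∈p∪q⁺ (map₁ In⊆ (x∈p∪q⁻ InCovSep AddSep e∈))) size)))))
      (≤-reflexive (eq k))
      where
      eq : ∀ k → 1 + (suc k + 2) ≡ k + 4
      eq = solve-∀

  mapWith∈-All : ∀ {A C : Set} {P : C → Set} (xs : List A) (f : ∀ {x} → x ∈ˡ xs → C) →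
    (∀ {x} (x∈ : x ∈ˡ xs) → P (f x∈)) → All P (mapWith∈ xs f)
  mapWith∈-All []       f p = []
  mapWith∈-All (x ∷ xs) f p = p (here refl) ∷ mapWith∈-All xs (f ∘ there) (p ∘ there)

  covStep : ℕ → ℕ
  covStep r = tryCost r + 5

  emptyAddSep-small : ∀ (CovSep : Subset n) → ∣ CovSep ∣ ≤ k → ∣ CovSep ∪ ⊥ ∣ ≤ k
  emptyAddSep-small CovSep = subst (λ S → ∣ S ∣ ≤ k) (sym (∪-identityʳ CovSep))

  singletonAddSeps-small : ∀ Edges CovSep → ∣ CovSep ∣ < k →
    All (λ (AddSep , _) → ∣ CovSep ∪ AddSep ∣ ≤ k) (singletonAddSeps Edges CovSep)
  singletonAddSeps-small Edges CovSep <k = mapWith∈-All (elements Edges) _ λ {e} _ →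
    ≤-trans (∣p∪q∣≤∣p∣+∣q∣ CovSep ⁅ e ⁆)
      (≤-trans (≤-reflexive (trans (cong (∣ CovSep ∣ +_) (∣⁅x⁆∣≡1 e)) (+-comm _ 1))) <k)

  length-singletonAddSeps : ∀ Edges CovSep → length (singletonAddSeps Edges CovSep) ≤ ∣ Edges ∣
  length-singletonAddSeps Edges CovSep =
    ≤-trans (≤-reflexive (length-mapWith∈ (setoid _) (elements Edges))) (length-elements Edges)

  one-choice : ∀ t → 2 + (1 * t + 1) ≤ 1 * (t + 5)
  one-choice t = ≤-trans (m≤m+n _ 2) (≤-reflexive (eq t))
    where
    eq : ∀ t → 2 + (1 * t + 1) + 2 ≡ 1 * (t + 5)
    eq = solve-∀

  many-choices : ∀ {l r} t → l ≤ r → 1 ≤ r → 4 + (l * t + 1) ≤ r * (t + 5)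
  many-choices {l} {r} t l≤r 1≤r = begin
    4 + (l * t + 1)  ≡⟨ eq (l * t) ⟩
    l * t + 1 * 5    ≤⟨ +-mono-≤ (*-monoˡ-≤ t l≤r) (*-monoˡ-≤ 5 1≤r) ⟩
    r * t + r * 5    ≡⟨ *-distribˡ-+ r t 5 ⟨
    r * (t + 5)      ∎
    where
    open ≤-Reasoning
    eq : ∀ x → 4 + (x + 1) ≡ x + 1 * 5
    eq = solve-∀

  abstract
    -- A full cover allows at most one choice, a smaller one at most `∣ Edges ∣`, which is what
    -- `weight` charges. The 5 in `covStep` pays for the tests and for reaching the end of the
    -- choices.
    decompAdd-spec : ∀ Edges (rec : Rec Edges) → RecSpec rec → ∀ Conn CovSep g → 1 ≤ ∣ Edges ∣ →
      Closed Conn Edges → Covers Conn CovSep → Consistent g →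
      Result Edges (weight ∣ Edges ∣ CovSep * covStep (∣ Edges ∣)) g (decompAdd Edges rec Conn CovSep g)
    decompAdd-spec Edges rec spec Conn CovSep g 1≤r cl (size , Conn⊆) con
      with nonempty? (CovSep ∩ Edges) | ∣ CovSep ∣ <? k
    ... | yes ne | yes _ = relax
      (≤-trans (one-choice (tryCost (∣ Edges ∣))) (*-monoˡ-≤ (covStep (∣ Edges ∣)) 1≤r))
      (delay {X = 2} ≤-refl (tryAddSeps-spec rec spec (emptyAddSep Edges CovSep ne) g cl Conn⊆
        (p∩q⊆p CovSep Edges) (emptyAddSep-small CovSep size ∷ []) con))
    ... | yes ne | no _ = relax (one-choice (tryCost (∣ Edges ∣)))
      (delay {X = 2} ≤-refl (tryAddSeps-spec rec spec (emptyAddSep Edges CovSep ne) g cl Conn⊆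
        (p∩q⊆p CovSep Edges) (emptyAddSep-small CovSep size ∷ []) con))
    ... | no _ | yes <k = relax (many-choices (tryCost (∣ Edges ∣)) (length-singletonAddSeps Edges CovSep) 1≤r)
      (delay {X = 4} ≤-refl (tryAddSeps-spec rec spec (singletonAddSeps Edges CovSep) g cl Conn⊆
        (p∩q⊆p CovSep Edges) (singletonAddSeps-small Edges CovSep <k) con))
    ... | no _ | no _ = idle con (≤-trans (m≤m+n 4 1) (≤-trans (m≤n+m 5 (tryCost (∣ Edges ∣))) (m≤m+n _ 0)))

  tryCovSeps-spec : ∀ Edges (rec : Rec Edges) → RecSpec rec → ∀ Conn CovSeps g → 1 ≤ ∣ Edges ∣ →
    Closed Conn Edges → All (Covers Conn) CovSeps → Consistent g →
    Result Edges (sum (map (weight ∣ Edges ∣) CovSeps) * covStep ∣ Edges ∣ + 1) g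
      (tryCovSeps Edges rec Conn CovSeps g)
  tryCovSeps-spec Edges rec spec Conn [] g 1≤r cl [] con = idle con ≤-refl
  tryCovSeps-spec Edges rec spec Conn (CovSep ∷ CovSeps) g 1≤r cl (cov ∷ covs) con
    with decompAdd Edges rec Conn CovSep g | decompAdd-spec Edges rec spec Conn CovSep g 1≤r cl cov con
  ... | c ▹ (just _ , g₁) | r = relax
    (+-mono-≤ (*-monoˡ-≤ (covStep (∣ Edges ∣)) (m≤m+n (weight (∣ Edges ∣) CovSep) _)) z≤n)
    (r ⨾ idle {X = 0} (consistent r) z≤n)
  ... | c ▹ (nothing , g₁) | r = relax
    (≤-reflexive (eq (weight (∣ Edges ∣) CovSep) (sum (map (weight (∣ Edges ∣)) CovSeps)) (covStep (∣ Edges ∣))))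
    (r ⨾ tryCovSeps-spec Edges rec spec Conn CovSeps g₁ 1≤r cl covs (consistent r))
    where
    eq : ∀ w s t → w * t + (s * t + 1) ≡ (w + s) * t + 1
    eq = solve-∀

  totalWeight-mono : ∀ r j {b b′} → b ≤ b′ → totalWeight r j b ≤ totalWeight r j b′
  totalWeight-mono r zero    b≤ = ≤-refl
  totalWeight-mono r (suc j) b≤ = *-mono-≤ (^-monoˡ-≤ j b≤) (+-monoˡ-≤ r b≤)

  -- In order: the size test, `boundEdges`, `cover`, and the loop over the covers with its end.
  ownCost : ℕ → ℕ
  ownCost r = 2 + (suc (n * 3) + ((3 * suc M) ^ k + (totalWeight r k (suc M) * covStep r + 1)))

  module _ (enough : ∀ r → 1 ≤ r → r ≤ n → ownCost r ≤ B * r) where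

    -- The charge `B * ∣ Edges ∣` is refunded when the caller records `Edges`. A call with at most
    -- `k` hyperedges already fits into `K₀`.
    decompCov-spec : ∀ Edges a Conn g → Ready Edges Conn g →
      Result Edges (B * ∣ Edges ∣ + K₀) g (decompCov Edges a Conn g)
    decompCov-spec Edges (acc rs) Conn g (cl , few , con) with ∣ Edges ∣ ≤? k
    ... | yes small = idle con (≤-trans
      (+-monoʳ-≤ 2 (+-monoˡ-≤ 1 (≤-trans (cost-⋃ Edges) (s≤s small))))
      (≤-trans (≤-reflexive (eq k)) (m≤n+m K₀ (B * ∣ Edges ∣))))
      where
      eq : ∀ k → 2 + (suc k + 1) ≡ k + 4
      eq = solve-∀
    ... | no large = relax
      (≤-trans (enough (∣ Edges ∣) 1≤r (∣p∣≤n Edges)) (m≤m+n _ K₀))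
      (delay {X = 2} ≤-refl (delay cost₁ (delay cost₂ (relax (+-monoˡ-≤ 1 (*-monoˡ-≤ (covStep (∣ Edges ∣)) heavy))
        (tryCovSeps-spec Edges _ (λ lt Conn′ g′ → decompCov-spec _ (rs lt) Conn′ g′)
          Conn (value (cover Conn Bound)) g 1≤r cl (cover-sound Conn Bound) con)))))
      where
      Bound : Subset n
      Bound = value (boundEdges Conn (elements ⊤))
      1≤r : 1 ≤ ∣ Edges ∣
      1≤r = ≤-trans (s≤s z≤n) (≰⇒> large)
      length≤M : suc (length (elements Bound)) ≤ suc M
      length≤M = s≤s (≤-trans (length-elements Bound) few)
      cost₁ : cost (boundEdges Conn (elements ⊤)) ≤ suc (n * 3)
      cost₁ = ≤-trans (cost-boundEdges Conn (elements ⊤))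
        (s≤s (*-monoˡ-≤ 3 (≤-trans (length-elements (⊤ {n})) (∣p∣≤n (⊤ {n})))))
      cost₂ : cost (cover Conn Bound) ≤ (3 * suc M) ^ k
      cost₂ = ≤-trans (cost-coverFrom k (elements Bound) Conn ⊥ ⊥ []) (^-monoˡ-≤ k (*-monoʳ-≤ 3 length≤M))
      heavy : sum (map (weight ∣ Edges ∣) (value (cover Conn Bound))) ≤ totalWeight ∣ Edges ∣ k (suc M)
      heavy = ≤-trans (cover-weight (∣ Edges ∣) 1≤r Conn Bound) (totalWeight-mono (∣ Edges ∣) k length≤M)

    -- The first product bounds the initial potential. The root call is recorded by no caller, so
    -- its own charge remains.
    runningTime≤ : runningTime k H ≤ 1 + (B * (suc n ^ k * n) + (B * n + K₀))
    runningTime≤ = s≤s (≤-trans (≤-reflexive (+-identityʳ _)) (≤-trans (m≤m+n _ _) (≤-trans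
      (amortised (decompCov-spec ⊤ (⊂-wellFounded ⊤) ⊥ (globals [] [])
        ((λ _ _ _ _ → ∈⊤) , ∣boundEdges∣≤ {Separator = ⊥} (elements ⊤) ⊥⊆ (≤-trans (≤-reflexive (∣⊥∣≡0 n)) z≤n)
          , λ { (inj₁ ()) ; (inj₂ ()) })))
      (+-mono-≤ (*-monoʳ-≤ B (Φ≤ (globals [] []))) (+-monoˡ-≤ K₀ (*-monoʳ-≤ B (∣p∣≤n (⊤ {n}))))))))

-- The constants and the final estimate.

^-distribʳ-* : ∀ k x y → (x * y) ^ k ≡ x ^ k * y ^ k
^-distribʳ-* zero    x y = refl
^-distribʳ-* (suc k) x y = trans (cong (x * y *_) (^-distribʳ-* k x y)) (eq x y (x ^ k) (y ^ k))
  where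
  eq : ∀ x y p q → x * y * (p * q) ≡ x * p * (y * q)
  eq = solve-∀

suc≤2* : ∀ {x} → 1 ≤ x → suc x ≤ 2 * x
suc≤2* {x} 1≤x = ≤-trans (+-monoˡ-≤ x 1≤x) (≤-reflexive (cong (x +_) (sym (+-identityʳ x))))

x≤x*y : ∀ x {y} → 1 ≤ y → x ≤ x * y
x≤x*y x 1≤y = m≤m*n x _ ⦃ >-nonZero 1≤y ⦄

x≤y*x : ∀ {y} x → 1 ≤ y → x ≤ y * x
x≤y*x x 1≤y = m≤n*m x _ ⦃ >-nonZero 1≤y ⦄

-- `choiceFactor` adds up the coefficients in `covStep≤`; the summands of `coverFactor` absorb those
-- of `ownCost` in the same order.
choiceFactor coverFactor : ℕ → ℕ
choiceFactor k = 4 * k + 52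
coverFactor k′ = 2 + (4 + (6 ^ suc k′ + (2 ^ k′ * (3 * choiceFactor (suc k′)) + 1)))

-- The four summands absorb those of `runningTime≤`; `2 ^ suc k′` comes from `suc n ≤ 2 * n`.
constant : ℕ → ℕ
constant k′ = 1 + (coverFactor k′ * 2 ^ suc k′ + (coverFactor k′ + (suc k′ + 4)))

module Bound {m n} (H : Hypergraph m n) (k′ : ℕ) (1≤n : 1 ≤ n) where
  k : ℕ
  k = suc k′
  open Covering H k
  open Amortisation H k using (K₀; Q)

  Z : ℕ
  Z = M ^ k * m ^ 2

  B : ℕ
  B = coverFactor k′ * Z

  open RunningTime H k B

  1≤m : 1 ≤ m
  1≤m = 1≤vertices 1≤n

  positive-M : 1 ≤ M
  positive-M = 1≤M (s≤s z≤n) 1≤n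

  1≤Mᵏ′ : 1 ≤ M ^ k′
  1≤Mᵏ′ = m^n>0 M ⦃ >-nonZero positive-M ⦄ k′

  M≤Mᵏ : M ≤ M ^ k
  M≤Mᵏ = x≤x*y M 1≤Mᵏ′

  m≤m² : m ≤ m ^ 2
  m≤m² = x≤x*y m (≤-trans 1≤m (x≤x*y m ≤-refl))

  Mm≤Z : M * m ≤ Z
  Mm≤Z = *-mono-≤ M≤Mᵏ m≤m²

  1≤Z : 1 ≤ Z
  1≤Z = ≤-trans (*-mono-≤ positive-M 1≤m) Mm≤Z

  n≤Mm : n ≤ M * m
  n≤Mm = n≤M*m (s≤s z≤n) 1≤m

  covStep≤ : ∀ {r} → 1 ≤ r → covStep r ≤ choiceFactor k * (m * r)
  covStep≤ {r} 1≤r = begin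
    covStep r                                            ≡⟨ eq k r m ⟩
    r * m + 5 * r + (2 * k + 27) * m + (2 * k + 19)
      ≤⟨ +-mono-≤ (+-mono-≤ (+-mono-≤ (≤-reflexive (*-comm r m)) (*-monoʳ-≤ 5 (x≤y*x r 1≤m)))
           (*-monoʳ-≤ (2 * k + 27) (x≤x*y m 1≤r)))
           (x≤x*y (2 * k + 19) (*-mono-≤ 1≤m 1≤r)) ⟩
    u + 5 * u + (2 * k + 27) * u + (2 * k + 19) * u      ≡⟨ eq′ k u ⟩
    choiceFactor k * u                                   ∎
    where
    open ≤-Reasoning
    u = m * r
    eq : ∀ k r m → 1 + ((k + r * (m + 4) + 16 * m + 7) + (suc m + ((r + m * (k + (k + 4) + 6) + 1) + (k + 4)))) + 5
                 ≡ r * m + 5 * r + (2 * k + 27) * m + (2 * k + 19)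
    eq = solve-∀
    eq′ : ∀ k u → u + 5 * u + (2 * k + 27) * u + (2 * k + 19) * u ≡ (4 * k + 52) * u
    eq′ = solve-∀

  -- Replacing `r` by `M * m` keeps the power of `M` at `k` and costs one factor `m`; the other
  -- factor of `m ^ 2` comes from `covStep≤`.
  totalWeight≤ : ∀ {r} → r ≤ n → totalWeight r k (suc M) ≤ 2 ^ k′ * M ^ k′ * (3 * (M * m))
  totalWeight≤ {r} r≤n = *-mono-≤
    (≤-trans (^-monoˡ-≤ k′ (suc≤2* positive-M)) (≤-reflexive (^-distribʳ-* k′ 2 M)))
    (begin
      suc M + r                ≤⟨ +-mono-≤ (suc≤2* positive-M) (≤-trans r≤n n≤Mm) ⟩
      2 * M + M * m            ≤⟨ +-monoˡ-≤ (M * m) (*-monoʳ-≤ 2 (x≤x*y M 1≤m)) ⟩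
      2 * (M * m) + M * m      ≡⟨ +-comm (2 * (M * m)) _ ⟩
      3 * (M * m)              ∎)
    where open ≤-Reasoning

  enough : ∀ r → 1 ≤ r → r ≤ n → ownCost r ≤ B * r
  enough r 1≤r r≤n = begin
    ownCost r
      ≤⟨ +-mono-≤ (x≤x*y 2 1≤Y) (+-mono-≤ bounds (+-mono-≤ covers (+-mono-≤ choices 1≤Y))) ⟩
    2 * Y + (4 * Y + (6 ^ k * Y + (w * Y + Y)))
      ≡⟨ eq (6 ^ k) w Z r ⟩
    B * r ∎
    where
    open ≤-Reasoning
    Y = Z * r
    w = 2 ^ k′ * (3 * choiceFactor k)
    1≤Y : 1 ≤ Y
    1≤Y = *-mono-≤ 1≤Z 1≤r
    Z≤Y : Z ≤ Y
    Z≤Y = x≤x*y Z 1≤r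
    bounds : suc (n * 3) ≤ 4 * Y
    bounds = ≤-trans (+-monoˡ-≤ (n * 3) 1≤n)
      (≤-trans (≤-reflexive (eq₁ n)) (*-monoʳ-≤ 4 (≤-trans n≤Mm (≤-trans Mm≤Z Z≤Y))))
      where
      eq₁ : ∀ n → n + n * 3 ≡ 4 * n
      eq₁ = solve-∀
    -- The 6 is 3 times the 2 from `suc M ≤ 2 * M`.
    covers : (3 * suc M) ^ k ≤ 6 ^ k * Y
    covers = begin
      (3 * suc M) ^ k      ≤⟨ ^-monoˡ-≤ k (*-monoʳ-≤ 3 (suc≤2* positive-M)) ⟩
      (3 * (2 * M)) ^ k    ≡⟨ cong (_^ k) (sym (*-assoc 3 2 M)) ⟩
      (6 * M) ^ k          ≡⟨ ^-distribʳ-* k 6 M ⟩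
      6 ^ k * M ^ k        ≤⟨ *-monoʳ-≤ (6 ^ k) (≤-trans (x≤x*y (M ^ k) (≤-trans 1≤m m≤m²)) Z≤Y) ⟩
      6 ^ k * Y            ∎
    choices : totalWeight r k (suc M) * covStep r ≤ w * Y
    choices = ≤-trans (*-mono-≤ (totalWeight≤ r≤n) (covStep≤ 1≤r))
      (≤-reflexive (eq₂ (2 ^ k′) (M ^ k′) M m (choiceFactor k) r))
      where
      eq₂ : ∀ t x M m a r → t * x * (3 * (M * m)) * (a * (m * r)) ≡ t * (3 * a) * (M * x * (m * (m * 1)) * r)
      eq₂ = solve-∀
    eq : ∀ s w Z r → 2 * (Z * r) + (4 * (Z * r) + (s * (Z * r) + (w * (Z * r) + Z * r)))
                   ≡ (2 + (4 + (s + (w + 1)))) * Z * r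
    eq = solve-∀

  bound : runningTime k H ≤ constant k′ * (n ^ (k + 1) * M ^ k * m ^ 2)
  bound = begin
    runningTime k H
      ≤⟨ runningTime≤ enough ⟩
    1 + (B * (suc n ^ k * n) + (B * n + (k + 4)))
      ≤⟨ +-mono-≤ 1≤X (+-mono-≤ separators (+-mono-≤ top (x≤x*y (k + 4) 1≤X))) ⟩
    X + (A * 2 ^ k * X + (A * X + (k + 4) * X))
      ≡⟨ eq A (2 ^ k) (k + 4) X ⟩
    (1 + (A * 2 ^ k + (A + (k + 4)))) * X
      ≡⟨ cong ((1 + (A * 2 ^ k + (A + (k + 4)))) *_) regroup ⟩
    (1 + (A * 2 ^ k + (A + (k + 4)))) * (n ^ (k + 1) * M ^ k * m ^ 2) ∎
    where
    open ≤-Reasoning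
    A = coverFactor k′
    X = n ^ k * n * Z
    1≤nᵏ : 1 ≤ n ^ k
    1≤nᵏ = m^n>0 n ⦃ >-nonZero 1≤n ⦄ k
    1≤X : 1 ≤ X
    1≤X = *-mono-≤ (*-mono-≤ 1≤nᵏ 1≤n) 1≤Z
    separators : B * (suc n ^ k * n) ≤ A * 2 ^ k * X
    separators = ≤-trans
      (*-monoʳ-≤ B (*-monoˡ-≤ n (≤-trans (^-monoˡ-≤ k (suc≤2* 1≤n)) (≤-reflexive (^-distribʳ-* k 2 n)))))
      (≤-reflexive (eq₁ A Z (2 ^ k) (n ^ k) n))
      where
      eq₁ : ∀ A Z t x n → A * Z * (t * x * n) ≡ A * t * (x * n * Z)
      eq₁ = solve-∀
    top : B * n ≤ A * X
    top = ≤-trans (*-monoʳ-≤ B (x≤y*x n 1≤nᵏ)) (≤-reflexive (eq₂ A Z (n ^ k) n))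
      where
      eq₂ : ∀ A Z x n → A * Z * (x * n) ≡ A * (x * n * Z)
      eq₂ = solve-∀
    eq : ∀ A t c X → X + (A * t * X + (A * X + c * X)) ≡ (1 + (A * t + (A + c))) * X
    eq = solve-∀
    regroup : X ≡ n ^ (k + 1) * M ^ k * m ^ 2
    regroup = trans (sym (*-assoc (n ^ k * n) (M ^ k) (m ^ 2))) (cong (λ p → p * M ^ k * m ^ 2)
      (trans (*-comm (n ^ k) n) (cong (n ^_) (+-comm 1 k))))

theorem2 : ∀ (k : ℕ) → 1 ≤ k →
    ∃[ C ] (∀ {m n : ℕ} (H : Hypergraph m n) → 1 ≤ n →
    runningTime k H ≤ C * (n ^ (k + 1) * (n ⊓ (maxIncident H * k)) ^ k * m ^ 2))
theorem2 (suc k′) _ = constant k′ , λ H 1≤n → Bound.bound H k′ 1≤n
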